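{- Let $N=[n]$ be a set of agents and $G$ a finite set of $m$ goods, and suppose every agent $i\in N$ has a matroid rank valuation $v_i:2^G\to\mathbb{R}_{\ge 0}$. Let $\pi:N\to[n]$ be a priority order. Then the Yankee Swap algorithm, run on $(N,G,\{v_i\})$ and $\pi$, terminates and outputs an allocation $X$ that is non-redundant and Lorenz dominating with respect to the priority order $\pi$.
   Context: A valuation $v:2^G\to\mathbb{R}_{\ge 0}$ is a matroid rank valuation (MRF) if $v(\emptyset)=0$, the marginal value $\Delta(S,g)=v(S\cup\{g\})-v(S)$ lies in $\{0,1\}$ for all $S\subseteq G,g\in G$, and $v$ is submodular ($\Delta(S,g)\ge\Delta(T,g)$ whenever $S\subseteq T$, $g\notin T$). An allocation is a partition $X=(X_0,X_1,\dots,X_n)$ of $G$; $X_i$ is agent $i$'s bundle and $X_0$ the unallocated goods. A dummy agent $0$ with valuation $v_0(S)=|S|$ is introduced. An allocation is non-redundant if $v_i(X_i)=|X_i|$ for every agent $i\in N\cup\{0\}$. A transfer path from agent $i$ to agent $j$ (both in $N\cup\{0\}$) in an allocation $X$ is a sequence of distinct goods $(g_1,\dots,g_k)$ with $g_k\in X_j$ such that, if $X'$ is obtained from $X$ by moving $g_k$ to the agent owning $g_{k-1}$ in $X$, $g_{k-1}$ to the agent owning $g_{k-2}$, ..., $g_2$ to the agent owning $g_1$, and $g_1$ to agent $i$ (each good is moved at most once, agents may appear several times), then $v_i(X'_i)=v_i(X_i)+1$, $v_j(X'_j)=v_j(X_j)-1$, and $v_h(X'_h)=v_h(X_h)$ for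 all other agents $h$. Yankee Swap: start with $X_0=G$, $X_i=\emptyset$ for $i\in N$, and $P=N$. While $P\neq\emptyset$: among agents in $P$ with minimum $|X_i|$, let $i$ be the one with highest priority (smallest $\pi(i)$); if a transfer path from $i$ to $0$ exists in $X$, execute it (updating $X$); otherwise remove $i$ from $P$. Output $X$. For an allocation $X$, its sorted utility vector is $(v_1(X_1),\dots,v_n(X_n))$ sorted in ascending order; $X$ Lorenz dominates $Y$ if for every $k\in[n]$ the sum of the $k$ smallest entries of $X$'s sorted utility vector is at least that of $Y$'s; $X$ is Lorenz dominating if it Lorenz dominates every allocation. An allocation is Lorenz dominating with respect to $\pi$ if it is Lorenz dominating in the augmented instance with valuations $v'_i(S)=v_i(S)+\pi(i)/n^2$. -}

module Defs where

open import Data.Nat using (ℕ; zero; suc; _+_; _*_; _∸_; _≤_)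
open import Data.Nat.Properties using (≤-decTotalOrder)
open import Data.Bool using (Bool; true; false; if_then_else_)
open import Data.Fin using (Fin; toℕ) renaming (zero to fzero; suc to fsuc)
import Data.Fin as F
open import Data.Fin.Subset using (Subset; _∪_; ⁅_⁆; _⊆_; _∈_; _∉_; ∣_∣; _-_; ⊤; ⊥)
open import Data.Vec using (tabulate)
open import Data.List using (List; []; _∷_; _∷ʳ_; map; take; allFin)
open import Data.Nat.ListAction using (sum)
open import Data.List.Relation.Unary.Unique.Propositional using (Unique)
open import Data.List.Sort ≤-decTotalOrder using (sort)
open import Data.Product using (Σ; ∃; _×_; _,_)
open import Data.Sum using (_⊎_)
open import Relation.Nullary using (¬_; does)
open import Relation.Binary.PropositionalEquality using (_≡_; _≢_)
open import Relation.Binary.Construct.Closure.ReflexiveTransitive using (Star)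
open import Induction.WellFounded using (Acc)

-- Valuations and matroid rank functions.
-- Goods are Fin m; a bundle is a Subset m.  Since v(∅)=0 and every
-- marginal is 0 or 1, an MRF only takes natural-number values, so we
-- take valuations into ℕ.

Valuation : ℕ → Set
Valuation m = Subset m → ℕ

Δ : ∀ {m} → Valuation m → Subset m → Fin m → ℕ
Δ v S g = v (S ∪ ⁅ g ⁆) ∸ v S

record IsMRF {m : ℕ} (v : Valuation m) : Set where
  field
    empty-zero  : v ⊥ ≡ 0
    -- Δ(S,g) ∈ {0,1} (stated without truncated subtraction)
    marginal01  : ∀ (S : Subset m) (g : Fin m) →
                  (v (S ∪ ⁅ g ⁆) ≡ v S) ⊎ (v (S ∪ ⁅ g ⁆) ≡ suc (v S))
    submodular  : ∀ (S T : Subset m) (g : Fin m) → S ⊆ T → g ∉ T →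
                  Δ v T g ≤ Δ v S g

-- Allocations.  Agents of N∪{0} are Fin (suc n): fzero is the dummy
-- agent 0 and fsuc i is agent i ∈ N = Fin n.  An allocation (a partition
-- (X_0,X_1,…,X_n) of G) is given by its owner map.

Allocation : ℕ → ℕ → Set
Allocation n m = Fin m → Fin (suc n)

bundle : ∀ {n m} → Allocation n m → Fin (suc n) → Subset m
bundle X a = tabulate (λ g → does (X g F.≟ a))

extVal : ∀ {n m} → (Fin n → Valuation m) → Fin (suc n) → Valuation m
extVal v fzero    = ∣_∣
extVal v (fsuc i) = v i

util : ∀ {n m} → (Fin n → Valuation m) → Allocation n m → Fin (suc n) → ℕ
util v X a = extVal v a (bundle X a)

NonRedundant : ∀ {n m} → (Fin n → Valuation m) → Allocation n m → Set
NonRedundant {n} v X = ∀ (a : Fin (suc n)) → util v X a ≡ ∣ bundle X a ∣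

applyPath : ∀ {n m} → Allocation n m → Fin (suc n) → List (Fin m) → Allocation n m
applyPath X r []       = X
applyPath X r (g ∷ gs) = λ h → if does (h F.≟ g) then r else applyPath X (X g) gs h

record TransferPath {n m} (v : Fin n → Valuation m) (X : Allocation n m)
                    (i j : Fin (suc n)) (gs : List (Fin m)) : Set where
  field
    distinct   : Unique gs
    ends-in-j  : ∃ λ (init : List (Fin m)) → ∃ λ (gk : Fin m) →
                   (gs ≡ init ∷ʳ gk) × (X gk ≡ j)
    gain-i     : util v (applyPath X i gs) i ≡ suc (util v X i)
    lose-j     : suc (util v (applyPath X i gs) j) ≡ util v X j
    others     : ∀ (h : Fin (suc n)) → h ≢ i → h ≢ j →
                   util v (applyPath X i gs) h ≡ util v X h

-- Yankee Swap, as a (nondeterministic in the choice of transfer path)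
-- transition system on states (X , P).

State : ℕ → ℕ → Set
State n m = Allocation n m × Subset n

Selected : ∀ {n m} → (Fin n → Fin n) → Allocation n m → Subset n → Fin n → Set
Selected π X P i =
  i ∈ P × (∀ k → k ∈ P →
    (∣ bundle X (fsuc i) ∣ Data.Nat.< ∣ bundle X (fsuc k) ∣)
    ⊎ ((∣ bundle X (fsuc i) ∣ ≡ ∣ bundle X (fsuc k) ∣) × (toℕ (π i) ≤ toℕ (π k))))

data YSStep {n m} (v : Fin n → Valuation m) (π : Fin n → Fin n) :
            State n m → State n m → Set where
  transfer : ∀ {X P i} (gs : List (Fin m)) → Selected π X P i →
             TransferPath v X (fsuc i) fzero gs →
             YSStep v π (X , P) (applyPath X (fsuc i) gs , P)
  remove   : ∀ {X P i} → Selected π X P i →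
             ¬ (∃ λ gs → TransferPath v X (fsuc i) fzero gs) →
             YSStep v π (X , P) (X , P - i)

initState : ∀ {n m} → State n m
initState = ((λ _ → fzero) , ⊤)

Terminates : ∀ {n m} → (Fin n → Valuation m) → (Fin n → Fin n) → State n m → Set
Terminates v π s = Acc (λ s' s₀ → YSStep v π s₀ s') s

Output : ∀ {n m} → (Fin n → Valuation m) → (Fin n → Fin n) → Allocation n m → Set
Output v π X = Star (YSStep v π) initState (X , ⊥)

-- Lorenz domination w.r.t. π.  Augmented valuations
-- v'_i(S) = v_i(S) + π(i)/n² with π(i) ∈ [n] = {1,…,n} (so π(i) is
-- toℕ (π i) + 1).  We multiply all augmented utilities by the positive
-- constant n², which does not affect Lorenz domination:
-- n² · v'_i(S) = n² · v_i(S) + π(i).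

augUtil : ∀ {n m} → (Fin n → Valuation m) → (Fin n → Fin n) →
          Allocation n m → Fin n → ℕ
augUtil {n} v π X i = n * n * v i (bundle X (fsuc i)) + suc (toℕ (π i))

sortedUtils : ∀ {n m} → (Fin n → Valuation m) → (Fin n → Fin n) →
              Allocation n m → List ℕ
sortedUtils {n} v π X = sort (map (augUtil v π X) (allFin n))

LorenzDominates : ∀ {n m} → (Fin n → Valuation m) → (Fin n → Fin n) →
                  Allocation n m → Allocation n m → Set
LorenzDominates {n} v π X Y =
  ∀ (k : ℕ) → 1 ≤ k → k ≤ n →
    sum (take k (sortedUtils v π Y)) ≤ sum (take k (sortedUtils v π X))

LorenzDominatingWrt : ∀ {n m} → (Fin n → Valuation m) → (Fin n → Fin n) →
                      Allocation n m → Set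
LorenzDominatingWrt v π X = ∀ Y → LorenzDominates v π X Y

{-# OPTIONS --safe #-}
module Submission where

-- Write X_a for the bundle of a.  A chordless path in the exchange graph from i to
-- an unallocated good is a transfer path: carrying out its first exchange leaves the
-- rest chordless.  If there is no such path, breadth-first search leaves a set of
-- goods Z whose complement is fully allocated, such that i and every owner a of a
-- good outside Z satisfies v_a(Z) ≤ |X_a ∩ Z|.  Then no allocation gives these agents
-- more in total.  Such sets are closed under intersection and survive later
-- transfers, so at every time one set Z accounts for all removed agents.
--
-- Give the step from a to a + 1 goods of agent i the key n²a + π(i).  Yankee Swap
-- grants steps in order of increasing key, so Z shows that for each θ the number of
-- granted steps of key below θ is maximal.  By Hermite's identity the truncated
-- deficit Σ_i (t ∸ v'_i) is a sum of such counts, hence minimal for each t, and this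
-- is equivalent to Lorenz domination.

open import Defs
import Data.Nat.Properties
open import Algebra.Properties.CommutativeMonoid.Sum Data.Nat.Properties.+-0-commutativeMonoid
  using (sum; ∑-distrib-+; ∑-comm; sum-cong-≗; sum-init-last; sum-replicate-zero)
open import Data.Bool using (Bool; true; false; if_then_else_; _∧_)
open import Data.Fin using (Fin; toℕ) renaming (zero to fzero; suc to fsuc)
import Data.Fin as F
import Data.Fin.Properties as F
open import Data.Fin.Subset
  using (Subset; inside; outside; ⊥; ⊤; ⁅_⁆; ∁; _∩_; _∪_; _─_; _-_; ∣_∣; Nonempty)
  renaming (_∈_ to _∈ₛ_; _∉_ to _∉ₛ_; _⊆_ to _⊆ₛ_)
open import Data.Fin.Subset.Properties
open import Data.List using (List; []; _∷_; _∷ʳ_; allFin; drop; filter; length; map; tabulate; take)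
open import Data.List.Membership.Propositional using (_∈_; _∉_; find; lose)
open import Data.List.Membership.Propositional.Properties using (∈-allFin; ∈-filter⁺; ∈-filter⁻)
open import Data.List.Properties using (filter-notAll; length-map; length-tabulate; map-tabulate; map-∘)
open import Data.List.Relation.Binary.Permutation.Propositional.Properties using (map⁺; ↭-length)
open import Data.List.Relation.Unary.All using (All; []; _∷_)
import Data.List.Relation.Unary.All as All
open import Data.List.Relation.Unary.AllPairs using ([]; _∷_)
open import Data.List.Relation.Unary.Any using (any?; here; there)
import Data.List.Relation.Unary.Any as Any
open import Data.List.Relation.Unary.Linked using (Linked; [-]; _∷_)
open import Data.List.Relation.Unary.Unique.Propositional using (Unique)
open import Data.List.Sort Data.Nat.Properties.≤-decTotalOrder using (sort; sort-↗; sort-↭)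
open import Data.Nat using (ℕ; zero; suc; _+_; _*_; _∸_; _≤_; _<_; z≤n; s≤s)
open import Data.Nat.DivMod
open import Data.Nat.Induction using (<-wellFounded)
import Data.Nat.ListAction as ListAction
open import Data.Nat.ListAction.Properties using (sum-↭)
open import Data.Nat.Properties
open import Data.Nat.Tactic.RingSolver using (solve-∀)
open import Data.Product using (∃; _×_; _,_; proj₁; proj₂)
import Data.Sum as Sum
open import Data.Sum using (_⊎_; inj₁; inj₂; [_,_]′)
open import Data.Unit using () renaming (⊤ to Unit)
import Data.Vec as Vec
open import Data.Vec using ([]; _∷_; here; there)
open import Data.Vec.Properties using ([]=⇒lookup; lookup⇒[]=; lookup∘tabulate; tabulate-cong)
open import Function using (_∘_; id; _⇔_; mk⇔; Equivalence)
open import Function.Definitions using (Injective)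
open import Induction.WellFounded using (Acc; acc; WellFounded; module Subrelation)
open import Relation.Binary using (tri<; tri≈; tri>)
open import Relation.Binary.Construct.Closure.ReflexiveTransitive using (Star; ε; _◅_)
import Relation.Binary.Construct.On as On
open import Relation.Binary.PropositionalEquality
  using (_≡_; _≢_; _≗_; refl; sym; trans; cong; cong₂; subst; module ≡-Reasoning)
open import Relation.Nullary using (¬_; Dec; yes; no; does; contradiction)
open import Relation.Nullary.Decidable using (dec-true; dec-false; ¬?; _×-dec_; _⊎-dec_)

-- Finite subsets and their cardinalities.

∪-mono-⊆ : ∀ {m} {A B C D : Subset m} → A ⊆ₛ C → B ⊆ₛ D → A ∪ B ⊆ₛ C ∪ D
∪-mono-⊆ f g = x∈p∪q⁺ ∘ Sum.map f g ∘ x∈p∪q⁻ _ _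

∪-lub : ∀ {m} {A B C : Subset m} → A ⊆ₛ C → B ⊆ₛ C → A ∪ B ⊆ₛ C
∪-lub f g = [ f , g ]′ ∘ x∈p∪q⁻ _ _

∩-glb : ∀ {m} {A B C : Subset m} → C ⊆ₛ A → C ⊆ₛ B → C ⊆ₛ A ∩ B
∩-glb f g x = x∈p∩q⁺ (f x , g x)

⁅⁆⊆ : ∀ {m} {A : Subset m} {g} → g ∈ₛ A → ⁅ g ⁆ ⊆ₛ A
⁅⁆⊆ {A = A} g∈A x∈ = subst (_∈ₛ A) (sym (x∈⁅y⁆⇒x≡y _ x∈)) g∈A

x∈p─q⇒x∉q : ∀ {m} {A B : Subset m} {x} → x ∈ₛ A ─ B → x ∉ₛ B
x∈p─q⇒x∉q {A = _ ∷ _} {inside ∷ _} () here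
x∈p─q⇒x∉q {A = _ ∷ _} {_ ∷ _} (there x∈) (there x∈B) = x∈p─q⇒x∉q x∈ x∈B

x∈p-y⇒x≢y : ∀ {m} {A : Subset m} {x y} → x ∈ₛ A - y → x ≢ y
x∈p-y⇒x≢y x∈ refl = x∈p─q⇒x∉q x∈ (x∈⁅x⁆ _)

⊆-∪─ : ∀ {m} (A B : Subset m) → A ⊆ₛ B ∪ (A ─ B)
⊆-∪─ A B {x} x∈A with x ∈? B
... | yes x∈B = x∈p∪q⁺ (inj₁ x∈B)
... | no  x∉B = x∈p∪q⁺ (inj₂ (x∈p∧x∉q⇒x∈p─q x∈A x∉B))

∣∣-modular : ∀ {m} (A B : Subset m) → ∣ A ∪ B ∣ + ∣ A ∩ B ∣ ≡ ∣ A ∣ + ∣ B ∣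
∣∣-modular []            []            = refl
∣∣-modular (inside ∷ A)  (inside ∷ B)  = cong suc (trans (+-suc _ _) (trans (cong suc (∣∣-modular A B)) (sym (+-suc _ _))))
∣∣-modular (inside ∷ A)  (outside ∷ B) = cong suc (∣∣-modular A B)
∣∣-modular (outside ∷ A) (inside ∷ B)  = trans (cong suc (∣∣-modular A B)) (sym (+-suc _ _))
∣∣-modular (outside ∷ A) (outside ∷ B) = ∣∣-modular A B

∣∣-split : ∀ {m} (A Z : Subset m) → ∣ A ∣ ≡ ∣ A ∩ Z ∣ + ∣ A ∩ ∁ Z ∣
∣∣-split []            []            = refl
∣∣-split (inside ∷ A)  (inside ∷ Z)  = cong suc (∣∣-split A Z)
∣∣-split (inside ∷ A)  (outside ∷ Z) = trans (cong suc (∣∣-split A Z)) (sym (+-suc _ _))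
∣∣-split (outside ∷ A) (_ ∷ Z)       = ∣∣-split A Z

-- Lifts the one-good axioms of `IsMRF` to statements about whole sets of goods.
subset-ind : ∀ {m} (Q : Subset m → Set) → Q ⊥ →
             (∀ S g → g ∉ₛ S → Q S → Q (S ∪ ⁅ g ⁆)) → ∀ S → Q S
subset-ind {zero}  Q q₀ q₁ [] = q₀
subset-ind {suc m} Q q₀ q₁ (b ∷ S) = extend b
  where
  out : Q (outside ∷ S)
  out = subset-ind (Q ∘ (outside ∷_)) q₀
          (λ T g g∉T → q₁ (outside ∷ T) (fsuc g) λ { (there g∈T) → g∉T g∈T }) S
  extend : ∀ b → Q (b ∷ S)
  extend outside = out
  extend inside  = subst (λ T → Q (inside ∷ T)) (∪-identityʳ S)
                     (q₁ (outside ∷ S) fzero (λ ()) out)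

∣S∪g∣ : ∀ {m} (S : Subset m) g → g ∉ₛ S → ∣ S ∪ ⁅ g ⁆ ∣ ≡ suc ∣ S ∣
∣S∪g∣ (inside ∷ S)  fzero    g∉S = contradiction here g∉S
∣S∪g∣ (outside ∷ S) fzero    g∉S = cong (suc ∘ ∣_∣) (∪-identityʳ S)
∣S∪g∣ (inside ∷ S)  (fsuc g) g∉S = cong suc (∣S∪g∣ S g (g∉S ∘ there))
∣S∪g∣ (outside ∷ S) (fsuc g) g∉S = ∣S∪g∣ S g (g∉S ∘ there)

∪-absorb : ∀ {m} {S : Subset m} {g} → g ∈ₛ S → S ∪ ⁅ g ⁆ ≡ S
∪-absorb {S = S} g∈S = ⊆-antisym (∪-lub id (⁅⁆⊆ g∈S)) (p⊆p∪q _)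

-- Allows the dummy agent to be treated like every other agent.
card-isMRF : ∀ {m} → IsMRF {m} ∣_∣
card-isMRF {m} = record
  { empty-zero = ∣⊥∣≡0 m
  ; marginal01 = marginal
  ; submodular = λ S T g S⊆T g∉T → ≤-reflexive
      (trans (Δ≡1 T g g∉T) (sym (Δ≡1 S g (g∉T ∘ S⊆T))))
  }
  where
  marginal : ∀ S g → (∣ S ∪ ⁅ g ⁆ ∣ ≡ ∣ S ∣) ⊎ (∣ S ∪ ⁅ g ⁆ ∣ ≡ suc ∣ S ∣)
  marginal S g with g ∈? S
  ... | yes g∈S = inj₁ (cong ∣_∣ (∪-absorb g∈S))
  ... | no  g∉S = inj₂ (∣S∪g∣ S g g∉S)
  Δ≡1 : ∀ S g → g ∉ₛ S → Δ ∣_∣ S g ≡ 1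
  Δ≡1 S g g∉S = trans (cong (_∸ ∣ S ∣) (∣S∪g∣ S g g∉S)) (m+n∸n≡m 1 ∣ S ∣)

-- Matroid rank functions

Addable : ∀ {m} → Valuation m → Subset m → Fin m → Set
Addable v S g = v S < v (S ∪ ⁅ g ⁆)

module Rank {m} {v : Valuation m} (mrf : IsMRF v) where
  open IsMRF mrf
  open ≤-Reasoning

  v-∪-≤ : ∀ S g → v (S ∪ ⁅ g ⁆) ≤ suc (v S)
  v-∪-≤ S g with marginal01 S g
  ... | inj₁ eq = m≤n⇒m≤1+n (≤-reflexive eq)
  ... | inj₂ eq = ≤-reflexive eq

  v-≤-∪ : ∀ S g → v S ≤ v (S ∪ ⁅ g ⁆)
  v-≤-∪ S g with marginal01 S g
  ... | inj₁ eq = ≤-reflexive (sym eq)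
  ... | inj₂ eq = ≤-trans (n≤1+n _) (≤-reflexive (sym eq))

  -- This is `submodular` freed from truncated subtraction. The case `g ∈ₛ T` can be included
  -- because the marginal over `T` is then zero.
  marginal-antitone : ∀ {S T} g → S ⊆ₛ T →
                      v (T ∪ ⁅ g ⁆) + v S ≤ v (S ∪ ⁅ g ⁆) + v T
  marginal-antitone {S} {T} g S⊆T with g ∈? T
  ... | yes g∈T rewrite ∪-absorb g∈T | +-comm (v T) (v S) = +-monoˡ-≤ (v T) (v-≤-∪ S g)
  ... | no  g∉T = begin
    v (T ∪ ⁅ g ⁆) + v S             ≤⟨ +-monoˡ-≤ (v S) (m≤n+m∸n _ (v T)) ⟩
    v T + Δ v T g + v S             ≤⟨ +-monoˡ-≤ (v S) (+-monoʳ-≤ (v T) (submodular S T g S⊆T g∉T)) ⟩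
    v T + Δ v S g + v S             ≡⟨ +-assoc (v T) _ _ ⟩
    v T + (Δ v S g + v S)           ≡⟨ cong (v T +_) (m∸n+n≡m (v-≤-∪ S g)) ⟩
    v T + v (S ∪ ⁅ g ⁆)             ≡⟨ +-comm (v T) _ ⟩
    v (S ∪ ⁅ g ⁆) + v T             ∎

  increment-antitone : ∀ {S T} → S ⊆ₛ T → ∀ D → v (T ∪ D) + v S ≤ v (S ∪ D) + v T
  increment-antitone {S} {T} S⊆T = subset-ind _ base step
    where
    base : v (T ∪ ⊥) + v S ≤ v (S ∪ ⊥) + v T
    base rewrite ∪-identityʳ S | ∪-identityʳ T = ≤-reflexive (+-comm (v T) (v S))
    step : ∀ D g → g ∉ₛ D → v (T ∪ D) + v S ≤ v (S ∪ D) + v T →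
           v (T ∪ (D ∪ ⁅ g ⁆)) + v S ≤ v (S ∪ (D ∪ ⁅ g ⁆)) + v T
    step D g _ ih rewrite sym (∪-assoc T D ⁅ g ⁆) | sym (∪-assoc S D ⁅ g ⁆) =
      -- The inequality for the single good `g` is added to the induction hypothesis; the two
      -- intermediate values then cancel.
      +-cancelʳ-≤ (v (T ∪ D) + v (S ∪ D)) _ _ (begin
        a + v S + (v (T ∪ D) + v (S ∪ D)) ≡⟨ shuffle a (v S) (v (T ∪ D)) _ ⟩
        a + v (S ∪ D) + (v (T ∪ D) + v S) ≤⟨ +-mono-≤ (marginal-antitone g (∪-mono-⊆ S⊆T id)) ih ⟩
        b + v (T ∪ D) + (v (S ∪ D) + v T) ≡⟨ shuffle b (v (T ∪ D)) (v (S ∪ D)) _ ⟩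
        b + v T + (v (S ∪ D) + v (T ∪ D)) ≡⟨ cong (b + v T +_) (+-comm (v (S ∪ D)) _) ⟩
        b + v T + (v (T ∪ D) + v (S ∪ D)) ∎)
      where
      a = v ((T ∪ D) ∪ ⁅ g ⁆)
      b = v ((S ∪ D) ∪ ⁅ g ⁆)
      shuffle : ∀ p q r s → p + q + (r + s) ≡ p + s + (r + q)
      shuffle = solve-∀

  v-≤-∪ʳ : ∀ S D → v S ≤ v (S ∪ D)
  v-≤-∪ʳ S = subset-ind _ (≤-reflexive (cong v (sym (∪-identityʳ S))))
    λ D g _ ih → ≤-trans ih (≤-trans (v-≤-∪ (S ∪ D) g) (≤-reflexive (cong v (∪-assoc S D ⁅ g ⁆))))

  mono : ∀ {S T} → S ⊆ₛ T → v S ≤ v T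
  mono {S} {T} S⊆T = ≤-trans (v-≤-∪ʳ S T)
    (≤-reflexive (cong v (⊆-antisym (∪-lub S⊆T id) (q⊆p∪q S T))))

  -- Submodularity for union and intersection, stated through inclusions so that its uses need no
  -- set identities.
  submodular-⊆ : ∀ {A B U W} → U ⊆ₛ A ∪ B → W ⊆ₛ A → W ⊆ₛ B → v U + v W ≤ v A + v B
  submodular-⊆ {A} {B} {U} {W} U⊆ W⊆A W⊆B = begin
    v U + v W       ≤⟨ +-monoˡ-≤ (v W) (mono (⊆-trans U⊆ (⊆-reflexive (∪-comm A B)))) ⟩
    v (B ∪ A) + v W ≤⟨ increment-antitone W⊆B A ⟩
    v (W ∪ A) + v B ≤⟨ +-monoˡ-≤ (v B) (mono (∪-lub W⊆A id)) ⟩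
    v A + v B       ∎

  v≤∣∣ : ∀ S → v S ≤ ∣ S ∣
  v≤∣∣ = subset-ind _ (≤-reflexive (trans empty-zero (sym (∣⊥∣≡0 m))))
    λ S g g∉S ih → ≤-trans (v-∪-≤ S g) (≤-trans (s≤s ih) (≤-reflexive (sym (∣S∪g∣ S g g∉S))))

  subadditive : ∀ {A B U} → U ⊆ₛ A ∪ B → v U ≤ v A + v B
  subadditive U⊆ = ≤-trans (m≤m+n _ (v ⊥)) (submodular-⊆ U⊆ ⊥⊆ ⊥⊆)

  -- The goods of `I` outside `J` add at most their number to `v J`, so a rank deficit of `J` would
  -- carry over to `I`.
  independent-⊆ : ∀ {I J} → v I ≡ ∣ I ∣ → J ⊆ₛ I → v J ≡ ∣ J ∣
  independent-⊆ {I} {J} ind J⊆I = ≤-antisym (v≤∣∣ J)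
    (+-cancelʳ-≤ ∣ I ∩ ∁ J ∣ _ _ (begin
      ∣ J ∣ + ∣ I ∩ ∁ J ∣     ≤⟨ +-monoˡ-≤ _ (p⊆q⇒∣p∣≤∣q∣ (∩-glb J⊆I id)) ⟩
      ∣ I ∩ J ∣ + ∣ I ∩ ∁ J ∣ ≡⟨ ∣∣-split I J ⟨
      ∣ I ∣                   ≡⟨ ind ⟨
      v I                     ≤⟨ subadditive cover ⟩
      v J + v (I ∩ ∁ J)       ≤⟨ +-monoʳ-≤ (v J) (v≤∣∣ _) ⟩
      v J + ∣ I ∩ ∁ J ∣       ∎))
    where
    cover : I ⊆ₛ J ∪ (I ∩ ∁ J)
    cover {x} x∈I with x ∈? J
    ... | yes x∈J = x∈p∪q⁺ (inj₁ x∈J)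
    ... | no  x∉J = x∈p∪q⁺ (inj₂ (x∈p∩q⁺ (x∈I , x∉p⇒x∈∁p x∉J)))

  addable-antitone : ∀ {S T g} → S ⊆ₛ T → Addable v T g → Addable v S g
  addable-antitone {S} {T} {g} S⊆T add = +-cancelʳ-≤ (v T) _ _ (begin
    suc (v S + v T)       ≡⟨ cong suc (+-comm (v S) _) ⟩
    suc (v T) + v S       ≤⟨ +-monoˡ-≤ (v S) add ⟩
    v (T ∪ ⁅ g ⁆) + v S   ≤⟨ marginal-antitone g S⊆T ⟩
    v (S ∪ ⁅ g ⁆) + v T   ∎)

  addable⇒∉ : ∀ {S g} → Addable v S g → g ∉ₛ S
  addable⇒∉ {S} add g∈S = <⇒≢ add (cong v (sym (∪-absorb g∈S)))

  addable-independent : ∀ {S g} → v S ≡ ∣ S ∣ → Addable v S g → v (S ∪ ⁅ g ⁆) ≡ ∣ S ∪ ⁅ g ⁆ ∣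
  addable-independent {S} {g} ind add = ≤-antisym (v≤∣∣ _) (begin
    ∣ S ∪ ⁅ g ⁆ ∣ ≡⟨ ∣S∪g∣ S g (addable⇒∉ add) ⟩
    suc ∣ S ∣     ≡⟨ cong suc ind ⟨
    suc (v S)     ≤⟨ add ⟩
    v (S ∪ ⁅ g ⁆) ∎)

  -- Within one independent set, spans intersect in the span of the intersection. Since `I₁ ∪ I₂` is
  -- independent, the union of `F₁` and `F₂` has rank at least `∣ I₁ ∪ I₂ ∣`; submodularity of rank
  -- and modularity of cardinality give the rest.
  spanned-∩ : ∀ {I I₁ I₂ F₁ F₂} → v I ≡ ∣ I ∣ → I₁ ⊆ₛ I → I₂ ⊆ₛ I → I₁ ⊆ₛ F₁ → I₂ ⊆ₛ F₂ →
              v F₁ ≤ ∣ I₁ ∣ → v F₂ ≤ ∣ I₂ ∣ → v (F₁ ∩ F₂) ≤ ∣ I₁ ∩ I₂ ∣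
  spanned-∩ {I} {I₁} {I₂} {F₁} {F₂} ind I₁⊆I I₂⊆I I₁⊆F₁ I₂⊆F₂ le₁ le₂ =
    +-cancelˡ-≤ ∣ I₁ ∪ I₂ ∣ _ _ (begin
      ∣ I₁ ∪ I₂ ∣ + v (F₁ ∩ F₂)     ≡⟨ cong (_+ v (F₁ ∩ F₂)) (independent-⊆ ind (∪-lub I₁⊆I I₂⊆I)) ⟨
      v (I₁ ∪ I₂) + v (F₁ ∩ F₂)     ≤⟨ submodular-⊆ (∪-mono-⊆ I₁⊆F₁ I₂⊆F₂) (p∩q⊆p F₁ F₂) (p∩q⊆q F₁ F₂) ⟩
      v F₁ + v F₂                   ≤⟨ +-mono-≤ le₁ le₂ ⟩
      ∣ I₁ ∣ + ∣ I₂ ∣               ≡⟨ ∣∣-modular I₁ I₂ ⟨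
      ∣ I₁ ∪ I₂ ∣ + ∣ I₁ ∩ I₂ ∣     ∎)

  spanned⇒v≤ : ∀ {J} Z → (∀ {z} → z ∈ₛ Z → ¬ Addable v J z) → v (J ∪ Z) ≤ v J
  spanned⇒v≤ {J} Z spanned = subset-ind (λ Y → Y ⊆ₛ Z → v (J ∪ Y) ≤ v J)
    (λ _ → ≤-reflexive (cong v (∪-identityʳ J)))
    (λ Y g _ ih Yg⊆Z → +-cancelʳ-≤ (v J) _ _ (begin
      v (J ∪ (Y ∪ ⁅ g ⁆)) + v J  ≡⟨ cong (λ A → v A + v J) (∪-assoc J Y ⁅ g ⁆) ⟨
      v ((J ∪ Y) ∪ ⁅ g ⁆) + v J  ≤⟨ marginal-antitone g (p⊆p∪q Y) ⟩
      v (J ∪ ⁅ g ⁆) + v (J ∪ Y)  ≤⟨ +-mono-≤ (≮⇒≥ (spanned (Yg⊆Z (x∈p∪q⁺ (inj₂ (x∈⁅x⁆ g))))))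
                                              (ih (Yg⊆Z ∘ p⊆p∪q _)) ⟩
      v J + v J                  ∎))
    Z id

  -- In matroid terms, for independent `S`: `h` lies on the circuit that `y` closes with `S`. Adding
  -- `g` keeps that circuit, so giving up `h` still makes room for `y`.
  addable-after-adding : ∀ {S g h y} → g ≢ h → Addable v S g → ¬ Addable v S y →
                         Addable v (S - h) y → Addable v ((S ∪ ⁅ g ⁆) - h) y
  addable-after-adding {S} {g} {h} {y} g≢h add-g ¬add-y add-y = begin-strict
    v ((S ∪ ⁅ g ⁆) - h)      ≤⟨ mono ⊆₁ ⟩
    v (W ∪ ⁅ g ⁆)            ≤⟨ v-∪-≤ W g ⟩
    suc (v W)                ≤⟨ add-y ⟩
    v (W ∪ ⁅ y ⁆)            ≤⟨ mono (∪-mono-⊆ (p─q⊆p S ⁅ h ⁆) id) ⟩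
    v (S ∪ ⁅ y ⁆)            ≤⟨ ≮⇒≥ ¬add-y ⟩
    v S                      <⟨ add-g ⟩
    v (S ∪ ⁅ g ⁆)            ≤⟨ +-cancelʳ-≤ (v (W ∪ ⁅ y ⁆)) _ _ below ⟩
    v (((S ∪ ⁅ g ⁆) - h) ∪ ⁅ y ⁆) ∎
    where
    W = S - h
    ⊆₁ : (S ∪ ⁅ g ⁆) - h ⊆ₛ W ∪ ⁅ g ⁆
    ⊆₁ x∈ with x∈p∪q⁻ S ⁅ g ⁆ (p─q⊆p _ _ x∈)
    ... | inj₁ x∈S = x∈p∪q⁺ (inj₁ (x∈p∧x≢y⇒x∈p-y x∈S (x∈p-y⇒x≢y x∈)))
    ... | inj₂ x∈g = x∈p∪q⁺ (inj₂ x∈g)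
    V = ((S ∪ ⁅ g ⁆) - h) ∪ ⁅ y ⁆
    W⊆ : W ⊆ₛ (S ∪ ⁅ g ⁆) - h
    W⊆ x∈ = x∈p∧x≢y⇒x∈p-y (p⊆p∪q _ (p─q⊆p _ _ x∈)) (x∈p-y⇒x≢y x∈)
    g∈ : ⁅ g ⁆ ⊆ₛ (S ∪ ⁅ g ⁆) - h
    g∈ = ⁅⁆⊆ (x∈p∧x≢y⇒x∈p-y (q⊆p∪q S _ (x∈⁅x⁆ g)) g≢h)
    -- `W ∪ ⁅ y ⁆` lies in both `V` and `S ∪ ⁅ y ⁆`, and their union contains `S ∪ ⁅ g ⁆`. The rank
    -- of `S ∪ ⁅ y ⁆` is at most `v S`, hence at most `suc (v W)`, because only `h` separates `S`
    -- from `W`.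
    below : v (S ∪ ⁅ g ⁆) + v (W ∪ ⁅ y ⁆) ≤ v V + v (W ∪ ⁅ y ⁆)
    below = begin
      v (S ∪ ⁅ g ⁆) + v (W ∪ ⁅ y ⁆)
        ≤⟨ submodular-⊆ {A = V} {B = S ∪ ⁅ y ⁆}
             (∪-lub (q⊆p∪q V _ ∘ p⊆p∪q _) (p⊆p∪q _ ∘ p⊆p∪q _ ∘ g∈))
             (∪-mono-⊆ W⊆ id) (∪-mono-⊆ (p─q⊆p S ⁅ h ⁆) id) ⟩
      v V + v (S ∪ ⁅ y ⁆)   ≤⟨ +-monoʳ-≤ (v V) (≮⇒≥ ¬add-y) ⟩
      v V + v S             ≤⟨ +-monoʳ-≤ (v V) (≤-trans (subadditive (⊆-∪─ S ⁅ h ⁆)) (+-monoˡ-≤ (v W) (≤-trans (v≤∣∣ ⁅ h ⁆) (≤-reflexive (∣⁅x⁆∣≡1 h))))) ⟩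
      v V + suc (v W)       ≤⟨ +-monoʳ-≤ (v V) add-y ⟩
      v V + v (W ∪ ⁅ y ⁆)   ∎

  -- Both `S - g` and `S - h` span `y`, so by `spanned-∩` their intersection does.
  not-addable-after-removing : ∀ {S g h y} → v S ≡ ∣ S ∣ → ¬ Addable v (S - g) y →
                               ¬ Addable v (S - h) y → ¬ Addable v ((S - g) - h) y
  not-addable-after-removing {S} {g} {h} {y} ind ¬g ¬h add = <-irrefl refl (begin-strict
    v ((S - g) - h)                          <⟨ add ⟩
    v (((S - g) - h) ∪ ⁅ y ⁆)                ≤⟨ mono (∩-glb (∪-mono-⊆ (p─q⊆p _ _) id) (∪-mono-⊆ ⊆h id)) ⟩
    v (((S - g) ∪ ⁅ y ⁆) ∩ ((S - h) ∪ ⁅ y ⁆)) ≤⟨ spanned-∩ ind (p─q⊆p S _) (p─q⊆p S _) (p⊆p∪q _) (p⊆p∪q _)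
                                                  (indep ¬g) (indep ¬h) ⟩
    ∣ (S - g) ∩ (S - h) ∣                    ≡⟨ independent-⊆ ind (⊆-trans (p∩q⊆p _ _) (p─q⊆p S _)) ⟨
    v ((S - g) ∩ (S - h))                    ≤⟨ mono ∩⊆ ⟩
    v ((S - g) - h)                          ∎)
    where
    indep : ∀ {z} → ¬ Addable v (S - z) y → v ((S - z) ∪ ⁅ y ⁆) ≤ ∣ S - z ∣
    indep ¬add = ≤-trans (≮⇒≥ ¬add) (v≤∣∣ _)
    ⊆h : (S - g) - h ⊆ₛ S - h
    ⊆h x∈ = x∈p∧x≢y⇒x∈p-y (p─q⊆p S _ (p─q⊆p (S - g) _ x∈)) (x∈p-y⇒x≢y x∈)
    ∩⊆ : (S - g) ∩ (S - h) ⊆ₛ (S - g) - h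
    ∩⊆ x∈ with x∈p∩q⁻ (S - g) (S - h) x∈
    ... | x∈g , x∈h = x∈p∧x≢y⇒x∈p-y x∈g (x∈p-y⇒x≢y x∈h)

  -- `R` will be the set of goods reached by a search, and the hypotheses say that no exchange leads
  -- out of it. The goods of `R` are removed from `S` one at a time. Each time `spanned-∩` shows
  -- that what remains still spans `∁ R`, until only goods outside `R` are left.
  closed⇒tight : ∀ {S} R → v S ≡ ∣ S ∣ →
                 (∀ {z} → z ∉ₛ R → ¬ Addable v S z) →
                 (∀ {z h} → z ∉ₛ R → h ∈ₛ S → h ∈ₛ R → ¬ Addable v (S - h) z) →
                 v (∁ R) ≤ ∣ S ∩ ∁ R ∣
  closed⇒tight {S} R ind spanned closed = begin
    v (∁ R)            ≤⟨ mono (p⊆p∪q _) ⟩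
    v (∁ R ∪ (S ─ R))  ≤⟨ subset-ind (λ Q → Q ⊆ₛ R → v (∁ R ∪ (S ─ Q)) ≤ ∣ S ─ Q ∣) base step R id ⟩
    ∣ S ─ R ∣          ≤⟨ p⊆q⇒∣p∣≤∣q∣ (∩-glb (p─q⊆p S R) (x∉p⇒x∈∁p ∘ x∈p─q⇒x∉q)) ⟩
    ∣ S ∩ ∁ R ∣        ∎
    where
    span : ∀ {J} → v J ≡ ∣ J ∣ → (∀ {z} → z ∉ₛ R → ¬ Addable v J z) → v (∁ R ∪ J) ≤ ∣ J ∣
    span {J} ind-J f = ≤-trans (≤-reflexive (cong v (∪-comm (∁ R) J)))
      (≤-trans (spanned⇒v≤ (∁ R) (f ∘ x∈∁p⇒x∉p)) (v≤∣∣ J))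
    base : ⊥ ⊆ₛ R → v (∁ R ∪ (S ─ ⊥)) ≤ ∣ S ─ ⊥ ∣
    base _ rewrite p─⊥≡p S = span ind spanned
    step : ∀ Q h → h ∉ₛ Q → (Q ⊆ₛ R → v (∁ R ∪ (S ─ Q)) ≤ ∣ S ─ Q ∣) →
           Q ∪ ⁅ h ⁆ ⊆ₛ R → v (∁ R ∪ (S ─ (Q ∪ ⁅ h ⁆))) ≤ ∣ S ─ (Q ∪ ⁅ h ⁆) ∣
    step Q h _ ih Qh⊆R rewrite sym (p─q─r≡p─q∪r S Q ⁅ h ⁆) with h ∈? S
    ... | yes h∈S = begin
      v (∁ R ∪ ((S ─ Q) - h))
        ≤⟨ mono (∩-glb (∪-mono-⊆ id (p─q⊆p _ _)) (∪-mono-⊆ id ⊆h)) ⟩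
      v ((∁ R ∪ (S ─ Q)) ∩ (∁ R ∪ (S - h)))
        ≤⟨ spanned-∩ ind (p─q⊆p S Q) (p─q⊆p S _) (q⊆p∪q (∁ R) _) (q⊆p∪q (∁ R) _)
             (ih (Qh⊆R ∘ p⊆p∪q _))
             (span (independent-⊆ ind (p─q⊆p S _)) λ z∉R → closed z∉R h∈S (Qh⊆R (q⊆p∪q Q _ (x∈⁅x⁆ h)))) ⟩
      ∣ (S ─ Q) ∩ (S - h) ∣
        ≤⟨ p⊆q⇒∣p∣≤∣q∣ (λ x∈ → let x∈₁ , x∈₂ = x∈p∩q⁻ (S ─ Q) (S - h) x∈ in x∈p∧x≢y⇒x∈p-y x∈₁ (x∈p-y⇒x≢y x∈₂)) ⟩
      ∣ (S ─ Q) - h ∣ ∎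
      where
      ⊆h : (S ─ Q) - h ⊆ₛ S - h
      ⊆h x∈ = x∈p∧x≢y⇒x∈p-y (p─q⊆p S _ (p─q⊆p (S ─ Q) _ x∈)) (x∈p-y⇒x≢y x∈)
    ... | no  h∉S = begin
      v (∁ R ∪ ((S ─ Q) - h)) ≤⟨ mono (∪-mono-⊆ id (p─q⊆p _ _)) ⟩
      v (∁ R ∪ (S ─ Q))       ≤⟨ ih (Qh⊆R ∘ p⊆p∪q _) ⟩
      ∣ S ─ Q ∣               ≤⟨ p⊆q⇒∣p∣≤∣q∣ {p = S ─ Q} {q = (S ─ Q) - h} (λ x∈ → x∈p∧x≢y⇒x∈p-y x∈ λ { refl → h∉S (p─q⊆p S Q x∈) }) ⟩
      ∣ (S ─ Q) - h ∣         ∎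

-- Moving goods

sum-mono : ∀ {n} {f g : Fin n → ℕ} → (∀ i → f i ≤ g i) → sum f ≤ sum g
sum-mono {zero}  f≤g = z≤n
sum-mono {suc n} f≤g = +-mono-≤ (f≤g fzero) (sum-mono (f≤g ∘ fsuc))

sum-≤-tight : ∀ {n} {f g : Fin n → ℕ} → (∀ i → f i ≤ g i) → sum g ≤ sum f → ∀ i → g i ≤ f i
sum-≤-tight {suc n} {f} {g} f≤g Σg≤Σf fzero = +-cancelʳ-≤ (sum (f ∘ fsuc)) _ _
  (≤-trans (+-monoʳ-≤ (g fzero) (sum-mono (f≤g ∘ fsuc))) Σg≤Σf)
sum-≤-tight {suc n} {f} {g} f≤g Σg≤Σf (fsuc i) = sum-≤-tight (f≤g ∘ fsuc)
  (+-cancelˡ-≤ (f fzero) _ _ (≤-trans (+-monoˡ-≤ _ (f≤g fzero)) Σg≤Σf)) i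

bit : Bool → ℕ
bit b = if b then 1 else 0

∣b∷S∣ : ∀ {m} b (S : Subset m) → ∣ b ∷ S ∣ ≡ bit b + ∣ S ∣
∣b∷S∣ true  S = refl
∣b∷S∣ false S = refl

module _ {m} {P : Fin m → Set} (P? : ∀ x → Dec (P x)) where

  ∈-comprehension⁺ : ∀ {x} → P x → x ∈ₛ Vec.tabulate (does ∘ P?)
  ∈-comprehension⁺ {x} px = lookup⇒[]= x _ (trans (lookup∘tabulate _ x) (dec-true (P? x) px))

  ∈-comprehension⁻ : ∀ {x} → x ∈ₛ Vec.tabulate (does ∘ P?) → P x
  ∈-comprehension⁻ {x} x∈ with P? x | trans (sym (lookup∘tabulate (does ∘ P?) x)) ([]=⇒lookup x∈)
  ... | yes px | _ = px
  ... | no _   | ()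

module _ {n m : ℕ} where

  ∈-bundle⁺ : ∀ (X : Allocation n m) {a g} → X g ≡ a → g ∈ₛ bundle X a
  ∈-bundle⁺ X {a} = ∈-comprehension⁺ (λ g → X g F.≟ a)

  ∈-bundle⁻ : ∀ (X : Allocation n m) {a g} → g ∈ₛ bundle X a → X g ≡ a
  ∈-bundle⁻ X {a} = ∈-comprehension⁻ (λ g → X g F.≟ a)

  bundle-cong : ∀ {X Y : Allocation n m} → X ≗ Y → ∀ a → bundle X a ≡ bundle Y a
  bundle-cong X≗Y a = tabulate-cong λ g → cong (λ b → does (b F.≟ a)) (X≗Y g)

∣bundle∩∣-total : ∀ {n m} (Y : Allocation n m) (R : Subset m) →
                  sum (λ a → ∣ bundle Y a ∩ R ∣) ≡ ∣ R ∣
∣bundle∩∣-total {n} Y []      = sum-replicate-zero (suc n)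
∣bundle∩∣-total {n} Y (r ∷ R) = begin
  sum (λ a → ∣ bundle Y a ∩ (r ∷ R) ∣)
    ≡⟨ sum-cong-≗ (λ a → ∣b∷S∣ (does (Y fzero F.≟ a) ∧ r) (bundle (Y ∘ fsuc) a ∩ R)) ⟩
  sum (λ a → bit (does (Y fzero F.≟ a) ∧ r) + ∣ bundle (Y ∘ fsuc) a ∩ R ∣)
    ≡⟨ ∑-distrib-+ (λ a → bit (does (Y fzero F.≟ a) ∧ r)) (λ a → ∣ bundle (Y ∘ fsuc) a ∩ R ∣) ⟩
  sum (λ a → bit (does (Y fzero F.≟ a) ∧ r)) + sum (λ a → ∣ bundle (Y ∘ fsuc) a ∩ R ∣)
    ≡⟨ cong₂ _+_ (total-owner (Y fzero) r) (∣bundle∩∣-total (Y ∘ fsuc) R) ⟩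
  bit r + ∣ R ∣
    ≡⟨ ∣b∷S∣ r R ⟨
  ∣ r ∷ R ∣ ∎
  where
  open ≡-Reasoning
  total-owner : ∀ {k} (b : Fin k) r → sum (λ a → bit (does (b F.≟ a) ∧ r)) ≡ bit r
  total-owner {suc k} fzero    r = trans (cong (bit r +_) (sum-replicate-zero k)) (+-identityʳ _)
  total-owner {suc k} (fsuc b) r = total-owner b r

δ : ∀ {k} → Fin k → Fin k → ℕ
δ a h = bit (does (a F.≟ h))

δ-refl : ∀ {k} (a : Fin k) → δ a a ≡ 1
δ-refl a = cong bit (dec-true (a F.≟ a) refl)

δ-≢ : ∀ {k} {a h : Fin k} → a ≢ h → δ a h ≡ 0
δ-≢ {a = a} {h} a≢h = cong bit (dec-false (a F.≟ h) a≢h)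

move : ∀ {n m} → Allocation n m → Fin m → Fin (suc n) → Allocation n m
move X g i = applyPath X i (g ∷ [])

-- With a Kronecker delta on each side there is neither a subtraction nor a case for `X g ≡ i`.
∣bundle-move∣ : ∀ {n m} (X : Allocation n m) g i h →
                ∣ bundle (move X g i) h ∣ + δ (X g) h ≡ ∣ bundle X h ∣ + δ i h
∣bundle-move∣ X fzero i h
  rewrite ∣b∷S∣ (does (i F.≟ h)) (bundle (X ∘ fsuc) h) | ∣b∷S∣ (does (X fzero F.≟ h)) (bundle (X ∘ fsuc) h) =
  rearrange (δ i h) _ (δ (X fzero) h)
  where
  rearrange : ∀ a b c → a + b + c ≡ c + b + a
  rearrange = solve-∀
∣bundle-move∣ X (fsuc g) i h
  rewrite ∣b∷S∣ (does (X fzero F.≟ h)) (bundle (move (X ∘ fsuc) g i) h)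
        | ∣b∷S∣ (does (X fzero F.≟ h)) (bundle (X ∘ fsuc) h) =
  trans (+-assoc (δ (X fzero) h) _ _)
    (trans (cong (δ (X fzero) h +_) (∣bundle-move∣ (X ∘ fsuc) g i h)) (sym (+-assoc (δ (X fzero) h) _ _)))

module _ {n m : ℕ} (X : Allocation n m) (g : Fin m) (i : Fin (suc n)) where

  move-same : move X g i g ≡ i
  move-same rewrite dec-true (g F.≟ g) refl = refl

  move-other : ∀ {h} → h ≢ g → move X g i h ≡ X h
  move-other {h} h≢g rewrite dec-false (h F.≟ g) h≢g = refl

  bundle-move-receiver : bundle (move X g i) i ≡ bundle X i ∪ ⁅ g ⁆
  bundle-move-receiver = ⊆-antisym to from
    where
    to : bundle (move X g i) i ⊆ₛ bundle X i ∪ ⁅ g ⁆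
    to {h} h∈ with h F.≟ g
    ... | yes refl = x∈p∪q⁺ (inj₂ (x∈⁅x⁆ g))
    ... | no  h≢g  = x∈p∪q⁺ (inj₁ (∈-bundle⁺ X (trans (sym (move-other h≢g)) (∈-bundle⁻ (move X g i) h∈))))
    from : bundle X i ∪ ⁅ g ⁆ ⊆ₛ bundle (move X g i) i
    from {h} h∈ with h F.≟ g | x∈p∪q⁻ (bundle X i) ⁅ g ⁆ h∈
    ... | yes refl | _        = ∈-bundle⁺ (move X g i) move-same
    ... | no  h≢g  | inj₁ h∈X = ∈-bundle⁺ (move X g i) (trans (move-other h≢g) (∈-bundle⁻ X h∈X))
    ... | no  h≢g  | inj₂ h∈g = contradiction (x∈⁅y⁆⇒x≡y g h∈g) h≢g

  bundle-move-rest : ∀ {a} → a ≢ i → bundle (move X g i) a ≡ bundle X a - g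
  bundle-move-rest {a} a≢i = ⊆-antisym to from
    where
    to : bundle (move X g i) a ⊆ₛ bundle X a - g
    to {h} h∈ with h F.≟ g
    ... | yes refl = contradiction (trans (sym (∈-bundle⁻ (move X g i) h∈)) move-same) a≢i
    ... | no  h≢g  = x∈p∧x≢y⇒x∈p-y (∈-bundle⁺ X (trans (sym (move-other h≢g)) (∈-bundle⁻ (move X g i) h∈))) h≢g
    from : bundle X a - g ⊆ₛ bundle (move X g i) a
    from h∈ = ∈-bundle⁺ (move X g i)
      (trans (move-other (x∈p-y⇒x≢y h∈)) (∈-bundle⁻ X (p─q⊆p _ _ h∈)))

  -- `applyPath` reads all receivers off the original allocation. Since `g` does not recur, moving
  -- it first changes none of the later receivers, so a path can be carried out one move at a time.
  applyPath-∷ : ∀ r gs → g ∉ gs →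
                (λ h → if does (h F.≟ g) then i else applyPath X r gs h) ≗ applyPath (move X g i) r gs
  applyPath-∷ r []       g∉gs h = refl
  applyPath-∷ r (x ∷ gs) g∉gs h rewrite move-other {x} (g∉gs ∘ here ∘ sym) with h F.≟ x
  ... | yes refl rewrite dec-false (h F.≟ g) (g∉gs ∘ here ∘ sym) = refl
  ... | no  _    = applyPath-∷ (X x) gs (g∉gs ∘ there) h

-- The counts telescope: each intermediate owner gives one good and receives the next, so only the
-- first receiver and the last owner change size.
∣bundle-applyPath∣ : ∀ {n m} (X : Allocation n m) i init gk → Unique (init ∷ʳ gk) → ∀ h →
  ∣ bundle (applyPath X i (init ∷ʳ gk)) h ∣ + δ (X gk) h ≡ ∣ bundle X h ∣ + δ i h
∣bundle-applyPath∣ X i []         gk _           h = ∣bundle-move∣ X gk i h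
∣bundle-applyPath∣ X i (g ∷ init) gk (g∉ ∷ uniq) h =
  +-cancelʳ-≡ (δ (X g) h) _ _ (begin
    size + δ (X gk) h + δ (X g) h                          ≡⟨ cong (λ S → ∣ S ∣ + δ (X gk) h + δ (X g) h) (bundle-cong eq h) ⟩
    ∣ bundle (applyPath X̂ (X g) (init ∷ʳ gk)) h ∣ + δ (X gk) h + δ (X g) h
      ≡⟨ cong (λ a → ∣ bundle (applyPath X̂ (X g) (init ∷ʳ gk)) h ∣ + δ a h + δ (X g) h) (move-other X g i (All.lookup g∉ (∈-last init) ∘ sym)) ⟨
    ∣ bundle (applyPath X̂ (X g) (init ∷ʳ gk)) h ∣ + δ (X̂ gk) h + δ (X g) h
      ≡⟨ cong (_+ δ (X g) h) (∣bundle-applyPath∣ X̂ (X g) init gk uniq h) ⟩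
    ∣ bundle X̂ h ∣ + δ (X g) h + δ (X g) h                 ≡⟨ cong (_+ δ (X g) h) (∣bundle-move∣ X g i h) ⟩
    ∣ bundle X h ∣ + δ i h + δ (X g) h                     ∎)
  where
  open ≡-Reasoning
  X̂ = move X g i
  size = ∣ bundle (applyPath X i (g ∷ init ∷ʳ gk)) h ∣
  eq : applyPath X i (g ∷ init ∷ʳ gk) ≗ applyPath X̂ (X g) (init ∷ʳ gk)
  eq = applyPath-∷ X g i (X g) (init ∷ʳ gk) λ g∈ → All.lookup g∉ g∈ refl
  ∈-last : ∀ xs → gk ∈ xs ∷ʳ gk
  ∈-last []       = here refl
  ∈-last (_ ∷ xs) = there (∈-last xs)

-- Chordless paths

module _ {m : ℕ} where

  -- The excluded shortcuts All (¬ S) keep the remaining exchanges valid when the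
  -- first one has been carried out.
  Chordless : (Fin m → Fin m → Set) → (Fin m → Set) → List (Fin m) → Set
  Chordless E S []       = Unit
  Chordless E S (g ∷ gs) = S g × All (¬_ ∘ S) gs × Chordless E (E g) gs

  -- A second occurrence of `g` would satisfy `S` and thus be an excluded shortcut.
  chordless-unique : ∀ {E S} gs → Chordless E S gs → Unique gs
  chordless-unique []       _            = []
  chordless-unique (g ∷ gs) (sg , ¬s , c) =
    All.map (λ ¬sh g≡h → ¬sh (subst _ g≡h sg)) ¬s ∷ chordless-unique gs c

  drop⊆ : ∀ (gs : List (Fin m)) {y} → y ∈ drop 1 gs → y ∈ gs
  drop⊆ (_ ∷ _) = there

  -- `Chordless` tests `E` only on targets behind the first good. The restriction to `drop 1 gs` is
  -- essential later: the first good of a remaining path is the target of the exchange just carried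
  -- out, and `exchange-move` does not apply to it.
  chordless-cong : ∀ {E E′ : Fin m → Fin m → Set} {S S′ : Fin m → Set} gs →
    (∀ {y} → y ∈ gs → S y ⇔ S′ y) →
    (∀ {x y} → x ∈ gs → y ∈ drop 1 gs → E x y ⇔ E′ x y) →
    Chordless E S gs → Chordless E′ S′ gs
  chordless-cong []       S⇔ E⇔ _             = _
  chordless-cong (g ∷ gs) S⇔ E⇔ (sg , ¬s , c) =
      Equivalence.to (S⇔ (here refl)) sg
    , All.tabulate (λ y∈ → All.lookup ¬s y∈ ∘ Equivalence.from (S⇔ (there y∈)))
    , chordless-cong gs (E⇔ (here refl)) (λ x∈ y∈ → E⇔ (there x∈) (drop⊆ gs y∈)) c

  Closed : List (Fin m) → (E : Fin m → Fin m → Set) (S T R : Fin m → Set) → Set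
  Closed U E S T R = (∀ {y} → y ∈ U → S y → R y)
                   × (∀ {x y} → R x → y ∈ U → E x y → R y)
                   × (∀ {x} → R x → ¬ T x)

  ChordlessPathTo : List (Fin m) → (E : Fin m → Fin m → Set) (S T : Fin m → Set) → Set
  ChordlessPathTo U E S T = ∃ λ init → ∃ λ g →
    Chordless E S (init ∷ʳ g) × T g × (∀ {y} → y ∈ init ∷ʳ g → y ∈ U)

  module _ {E : Fin m → Fin m → Set} (E? : ∀ x y → Dec (E x y))
           {T : Fin m → Set} (T? : ∀ x → Dec (T x)) where

    private
      -- `U` lists the goods not yet visited, and its length decreases because the current layer is
      -- filtered out. If no layer meets `T`, the layers together form the closed set.
      search : ∀ U → Acc _<_ (length U) → ∀ {S} → (∀ x → Dec (S x)) →
               ChordlessPathTo U E S T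
               ⊎ (∃ λ (R : Subset m) → Closed U E S T (_∈ₛ R))
      search U (acc rs) {S} S? with any? (λ x → S? x ×-dec T? x) U
      ... | yes st with find st
      ...   | g , g∈U , sg , tg = inj₁ ([] , g , (sg , [] , _) , tg , λ { (here refl) → g∈U })
      search U (acc rs) {S} S? | no ¬st with any? S? U
      ...   | no ¬s = inj₂ (⊥ , (λ y∈U sy → contradiction (lose y∈U sy) ¬s)
                              , (λ x∈⊥ → contradiction x∈⊥ ∉⊥) , (λ x∈⊥ → contradiction x∈⊥ ∉⊥))
      ...   | yes s = extend (search U′ (rs (filter-notAll (¬? ∘ S?) U (Any.map (λ sx ¬sx → ¬sx sx) s))) S′?)
        where
        -- The next breadth-first layer; a path from S′ outside S extends to a chordless
        -- path from S because it contains no further good of S.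
        S′ : Fin m → Set
        S′ y = ∃ λ x → (x ∈ U × S x) × E x y
        S′? : ∀ y → Dec (S′ y)
        S′? y = F.any? λ x → (any? (x F.≟_) U ×-dec S? x) ×-dec E? x y
        U′ = filter (¬? ∘ S?) U
        ¬S : ∀ {y} → y ∈ U′ → ¬ S y
        ¬S = proj₂ ∘ ∈-filter⁻ (¬? ∘ S?) {xs = U}
        U′⊆U : ∀ {y} → y ∈ U′ → y ∈ U
        U′⊆U = proj₁ ∘ ∈-filter⁻ (¬? ∘ S?) {xs = U}
        prepend : ∀ gs → Chordless E S′ gs → (∀ {y} → y ∈ gs → y ∈ U′) →
                  gs ≢ [] → ∃ λ x → x ∈ U × Chordless E S (x ∷ gs)
        prepend []       _ _ ne = contradiction refl ne
        -- An edge from `x` to a good after `g` would put that good into `S′`, which the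
        -- chordlessness of the given path excludes.
        prepend (g ∷ gs) ((x , (x∈U , sx) , e) , ¬s′ , c) ⊆U′ _ =
          x , x∈U , sx , All.tabulate (¬S ∘ ⊆U′)
            , e , All.map (λ ¬s′y e′ → ¬s′y (x , (x∈U , sx) , e′)) ¬s′ , c
        ∷ʳ≢[] : ∀ xs {y : Fin m} → xs ∷ʳ y ≢ []
        ∷ʳ≢[] []       ()
        ∷ʳ≢[] (_ ∷ _) ()
        extend : ChordlessPathTo U′ E S′ T ⊎ (∃ λ (R : Subset m) → Closed U′ E S′ T (_∈ₛ R)) →
                 ChordlessPathTo U E S T ⊎ (∃ λ (R : Subset m) → Closed U E S T (_∈ₛ R))
        extend (inj₁ (init , g , c , tg , ⊆U′)) with prepend (init ∷ʳ g) c ⊆U′ (∷ʳ≢[] init)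
        ... | x , x∈U , c′ = inj₁ (x ∷ init , g , c′ , tg , λ { (here refl) → x∈U ; (there y∈) → U′⊆U (⊆U′ y∈) })
        extend (inj₂ (R , source , step , ¬T)) = inj₂ (R⁺ , source⁺ , step⁺ , ¬T⁺)
          where
          Q : Fin m → Set
          Q y = (y ∈ U × S y) ⊎ y ∈ₛ R
          Q? : ∀ y → Dec (Q y)
          Q? y = (any? (y F.≟_) U ×-dec S? y) ⊎-dec (y ∈? R)
          R⁺ = Vec.tabulate (does ∘ Q?)
          to : ∀ {y} → Q y → y ∈ₛ R⁺
          to = ∈-comprehension⁺ Q?
          from : ∀ {y} → y ∈ₛ R⁺ → Q y
          from = ∈-comprehension⁻ Q?
          source⁺ : ∀ {y} → y ∈ U → S y → y ∈ₛ R⁺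
          source⁺ y∈U sy = to (inj₁ (y∈U , sy))
          step⁺ : ∀ {x y} → x ∈ₛ R⁺ → y ∈ U → E x y → y ∈ₛ R⁺
          step⁺ {x} {y} x∈ y∈U e with S? y
          ... | yes sy = source⁺ y∈U sy
          ... | no ¬sy with from x∈
          ...   | inj₁ xs  = to (inj₂ (source (∈-filter⁺ (¬? ∘ S?) y∈U ¬sy) (x , xs , e)))
          ...   | inj₂ x∈R = to (inj₂ (step x∈R (∈-filter⁺ (¬? ∘ S?) y∈U ¬sy) e))
          ¬T⁺ : ∀ {x} → x ∈ₛ R⁺ → ¬ T x
          ¬T⁺ x∈ t with from x∈
          ... | inj₁ (x∈U , sx) = ¬st (lose x∈U (sx , t))
          ... | inj₂ x∈R        = ¬T x∈R t

    chordless-path-or-closed : ∀ {S} → (∀ x → Dec (S x)) →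
      ChordlessPathTo (allFin m) E S T ⊎ (∃ λ (R : Subset m) → Closed (allFin m) E S T (_∈ₛ R))
    chordless-path-or-closed = search (allFin m) (<-wellFounded _)

-- The exchange graph and the effect of one exchange.

module _ {n m : ℕ} (v : Fin n → Valuation m) (mrf : ∀ i → IsMRF (v i)) where

  extVal-isMRF : ∀ a → IsMRF (extVal v a)
  extVal-isMRF fzero    = card-isMRF
  extVal-isMRF (fsuc i) = mrf i

  -- The edge relation of the exchange graph: the owner of the first good can use the second in its
  -- place.
  Exchange : Allocation n m → Fin m → Fin m → Set
  Exchange X g = Addable (extVal v (X g)) (bundle X (X g) - g)

  module _ (X : Allocation n m) (g : Fin m) (i : Fin (suc n))
           (nr : NonRedundant v X) (add : Addable (extVal v i) (bundle X i) g) where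

    private X̂ = move X g i

    owner≢receiver : X g ≢ i
    owner≢receiver eq = Rank.addable⇒∉ (extVal-isMRF i) add (∈-bundle⁺ X eq)

    move-nonRedundant : NonRedundant v X̂
    move-nonRedundant a with a F.≟ i
    ... | yes refl rewrite bundle-move-receiver X g i = Rank.addable-independent (extVal-isMRF i) (nr i) add
    ... | no  a≢i  rewrite bundle-move-rest X g i a≢i = Rank.independent-⊆ (extVal-isMRF a) (nr a) (p─q⊆p _ _)

    -- Only the receiver and the previous owner of `g` change bundles. For the receiver, `¬add-y`
    -- makes `addable-after-adding` apply; for the previous owner, `¬exch-y` makes
    -- `not-addable-after-removing` apply. Both hypotheses are absences of chords.
    exchange-move : ∀ {x y} → x ≢ g → ¬ Addable (extVal v i) (bundle X i) y →
                    ¬ Exchange X g y → Exchange X x y ⇔ Exchange X̂ x y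
    exchange-move {x} {y} x≢g ¬add-y ¬exch-y rewrite move-other X g i x≢g = equiv (X x)
      where
      equiv : ∀ a → Addable (extVal v a) (bundle X a - x) y ⇔ Addable (extVal v a) (bundle X̂ a - x) y
      equiv a with a F.≟ i
      ... | yes refl rewrite bundle-move-receiver X g i =
        mk⇔ (Rank.addable-after-adding (extVal-isMRF i) (x≢g ∘ sym) add ¬add-y)
            (Rank.addable-antitone (extVal-isMRF i) λ z∈ → x∈p∧x≢y⇒x∈p-y (p⊆p∪q _ (p─q⊆p _ _ z∈)) (x∈p-y⇒x≢y z∈))
      ... | no a≢i rewrite bundle-move-rest X g i a≢i = mk⇔
        (Rank.addable-antitone (extVal-isMRF a) λ z∈ → x∈p∧x≢y⇒x∈p-y (p─q⊆p _ _ (p─q⊆p _ _ z∈)) (x∈p-y⇒x≢y z∈))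
        (back (X g F.≟ a))
        where
        back : Dec (X g ≡ a) → Addable (extVal v a) ((bundle X a - g) - x) y → Addable (extVal v a) (bundle X a - x) y
        back (yes refl) add′ with extVal v a (bundle X a - x) <? extVal v a ((bundle X a - x) ∪ ⁅ y ⁆)
        ... | yes p = p
        ... | no ¬p = contradiction add′ (Rank.not-addable-after-removing (extVal-isMRF a) (nr a) ¬exch-y ¬p)
        back (no ¬eq) = Rank.addable-antitone (extVal-isMRF a) λ z∈ →
          x∈p∧x≢y⇒x∈p-y (x∈p∧x≢y⇒x∈p-y (p─q⊆p _ _ z∈) λ { refl → ¬eq (∈-bundle⁻ X (p─q⊆p _ _ z∈)) }) (x∈p-y⇒x≢y z∈)

  -- Induction along the path, carrying out its first move. The rest is chordless in the new
  -- allocation: the previous owner of `g` has now given it up, so its exchanges for `g` have become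
  -- plain additions, and `exchange-move` preserves the other edges.
  chordless-nonRedundant : ∀ gs X i → NonRedundant v X →
    Chordless (Exchange X) (Addable (extVal v i) (bundle X i)) gs → NonRedundant v (applyPath X i gs)
  chordless-nonRedundant []       X i nr _ = nr
  chordless-nonRedundant (g ∷ gs) X i nr (add , ¬add , c) a = subst (λ S → extVal v a S ≡ ∣ S ∣)
    (sym (bundle-cong (applyPath-∷ X g i (X g) gs g∉gs) a))
    (chordless-nonRedundant gs (move X g i) (X g) (move-nonRedundant X g i nr add)
      (chordless-cong gs (λ {y} _ → source y)
        (λ x∈ y∈ → exchange-move X g i nr add (λ { refl → g∉gs x∈ })
                     (All.lookup ¬add (drop⊆ gs y∈)) (no-shortcut gs c y∈)) c) a)
    where
    g∉gs : g ∉ gs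
    g∉gs g∈ = All.lookup ¬add g∈ add
    source : ∀ y → Exchange X g y ⇔ Addable (extVal v (X g)) (bundle (move X g i) (X g)) y
    source y = subst (λ S → Exchange X g y ⇔ Addable (extVal v (X g)) S y)
      (sym (bundle-move-rest X g i (owner≢receiver X g i nr add))) (mk⇔ id id)
    no-shortcut : ∀ {E S} hs {y} → Chordless E S hs → y ∈ drop 1 hs → ¬ S y
    no-shortcut (_ ∷ hs) (_ , ¬s , _) y∈ = All.lookup ¬s y∈

-- Certificates for removed agents

module Certificates {n m : ℕ} (v : Fin n → Valuation m) (mrf : ∀ i → IsMRF (v i)) where
  open ≤-Reasoning

  private
    V : Fin (suc n) → Valuation m
    V = extVal v
    module V a = Rank (extVal-isMRF v mrf a)

  -- For non-redundant `X` this says that `bundle X a ∩ Z` is a maximal independent subset of `Z`: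
  -- agent `a` draws as much value from `Z` as possible.
  Tight : Allocation n m → Subset m → Fin (suc n) → Set
  Tight X Z a = V a Z ≤ ∣ bundle X a ∩ Z ∣

  Cover : Allocation n m → Subset m → Set
  Cover X Z = ∀ g → g ∉ₛ Z → X g ≢ fzero × Tight X Z (X g)

  -- Along a chordless path utilities stay equal to sizes, so counting goods yields the utility
  -- conditions of a transfer path. Otherwise the goods reached by the search form a closed set `R`,
  -- and `closed⇒tight` applies with `Z` equal to `∁ R`.
  transfer-or-cover : ∀ {X} → NonRedundant v X → ∀ i →
    (∃ λ gs → TransferPath v X (fsuc i) fzero gs) ⊎ (∃ λ Z → Cover X Z × Tight X Z (fsuc i))
  transfer-or-cover {X} nr i with
    chordless-path-or-closed {E = Exchange v mrf X} (λ x y → _ <? _) (λ x → X x F.≟ fzero)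
      {S = Addable (V (fsuc i)) (bundle X (fsuc i))} (λ x → _ <? _)
  ... | inj₁ (init , gk , c , owner , _) = inj₁ (init ∷ʳ gk , record
    { distinct  = unique
    ; ends-in-j = init , gk , refl , owner
    ; gain-i    = trans (sym (+-identityʳ _)) (trans (size (fsuc i))
                    (trans (cong (util v X (fsuc i) +_) (δ-refl (fsuc i))) (+-comm _ 1)))
    ; lose-j    = trans (+-comm 1 _) (trans (size fzero) (+-identityʳ _))
    ; others    = λ h h≢i h≢0 → trans (trans (sym (+-identityʳ _))
                    (trans (cong (util v Y h +_) (sym (δ-≢ (h≢0 ∘ sym)))) (size h)))
                    (trans (cong (util v X h +_) (δ-≢ (h≢i ∘ sym))) (+-identityʳ _))
    })
    where
    Y = applyPath X (fsuc i) (init ∷ʳ gk)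
    unique = chordless-unique (init ∷ʳ gk) c
    size : ∀ h → util v Y h + δ fzero h ≡ util v X h + δ (fsuc i) h
    size h rewrite chordless-nonRedundant v mrf (init ∷ʳ gk) X (fsuc i) nr c h | nr h | sym owner =
      ∣bundle-applyPath∣ X (fsuc i) init gk unique h
  ... | inj₂ (R , source , step , ¬T) = inj₂ (∁ R , cover , tight (fsuc i) λ z∉R add → z∉R (source (∈-allFin _) add))
    where
    tight : ∀ a → (∀ {z} → z ∉ₛ R → ¬ Addable (V a) (bundle X a) z) → Tight X (∁ R) a
    tight a spanned = V.closed⇒tight a R (nr a) spanned
      λ { z∉R h∈X h∈R add → z∉R (step h∈R (∈-allFin _)
            (subst (λ b → Addable (V b) (bundle X b - _) _) (sym (∈-bundle⁻ X h∈X)) add)) }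
    cover : Cover X (∁ R)
    cover g g∉ = ¬T g∈R , tight (X g) λ z∉R add → z∉R (step g∈R (∈-allFin _)
        -- A good that the owner of `g` could add outright can also be taken in exchange for `g`, so
        -- it would have been reached from `g`.
        (V.addable-antitone (X g) (p─q⊆p _ _) add))
      where g∈R = x∉∁p⇒x∈p g∉

  -- If `a` is tight for `Z₂` as well, `spanned-∩` applies. Otherwise `cover₂` forbids `a` to own a
  -- good outside `Z₂`, and intersecting with `Z₂` loses none of its goods.
  tight-∩ : ∀ {X Z₁ Z₂} → NonRedundant v X → ∀ {a} → Tight X Z₁ a → Cover X Z₂ → Tight X (Z₁ ∩ Z₂) a
  tight-∩ {X} {Z₁} {Z₂} nr {a} tight₁ cover₂ with V a Z₂ ≤? ∣ bundle X a ∩ Z₂ ∣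
  ... | yes tight₂ = begin
    V a (Z₁ ∩ Z₂)      ≤⟨ V.spanned-∩ a (nr a) (p∩q⊆p _ _) (p∩q⊆p _ _) (p∩q⊆q _ _) (p∩q⊆q _ _) tight₁ tight₂ ⟩
    ∣ (bundle X a ∩ Z₁) ∩ (bundle X a ∩ Z₂) ∣
      ≤⟨ p⊆q⇒∣p∣≤∣q∣ {p = (bundle X a ∩ Z₁) ∩ (bundle X a ∩ Z₂)} {q = bundle X a ∩ (Z₁ ∩ Z₂)}
           (λ x∈ → let x∈₁ , x∈₂ = x∈p∩q⁻ _ _ x∈ in
             x∈p∩q⁺ (p∩q⊆p _ _ x∈₁ , x∈p∩q⁺ (p∩q⊆q _ _ x∈₁ , p∩q⊆q _ _ x∈₂))) ⟩
    ∣ bundle X a ∩ (Z₁ ∩ Z₂) ∣ ∎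
  ... | no ¬tight₂ = begin
    V a (Z₁ ∩ Z₂)      ≤⟨ V.mono a (p∩q⊆p _ _) ⟩
    V a Z₁             ≤⟨ tight₁ ⟩
    ∣ bundle X a ∩ Z₁ ∣
      ≤⟨ p⊆q⇒∣p∣≤∣q∣ {p = bundle X a ∩ Z₁} {q = bundle X a ∩ (Z₁ ∩ Z₂)}
           (λ x∈ → let x∈X , x∈₁ = x∈p∩q⁻ _ _ x∈ in x∈p∩q⁺ (x∈X , x∈p∩q⁺ (x∈₁ , X⊆Z₂ x∈X))) ⟩
    ∣ bundle X a ∩ (Z₁ ∩ Z₂) ∣ ∎
    where
    X⊆Z₂ : bundle X a ⊆ₛ Z₂
    X⊆Z₂ {x} x∈X with x ∈? Z₂
    ... | yes x∈Z₂ = x∈Z₂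
    ... | no  x∉Z₂ = contradiction (subst (Tight X Z₂) (∈-bundle⁻ X x∈X) (proj₂ (cover₂ x x∉Z₂))) ¬tight₂

  tight-∩ʳ : ∀ {X Z₁ Z₂} → NonRedundant v X → ∀ {a} → Cover X Z₁ → Tight X Z₂ a → Tight X (Z₁ ∩ Z₂) a
  tight-∩ʳ {X} {Z₁} {Z₂} nr cover₁ tight₂ =
    subst (λ Z → Tight X Z _) (∩-comm Z₂ Z₁) (tight-∩ nr tight₂ cover₁)

  cover-∩ : ∀ {X Z₁ Z₂} → NonRedundant v X → Cover X Z₁ → Cover X Z₂ → Cover X (Z₁ ∩ Z₂)
  cover-∩ {X} {Z₁} {Z₂} nr cover₁ cover₂ g g∉ with g ∈? Z₁
  ... | no g∉₁  = proj₁ (cover₁ g g∉₁) , tight-∩ nr (proj₂ (cover₁ g g∉₁)) cover₂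
  ... | yes g∈₁ = proj₁ (cover₂ g g∉₂) , tight-∩ʳ nr cover₁ (proj₂ (cover₂ g g∉₂))
    where
    g∉₂ : g ∉ₛ Z₂
    g∉₂ g∈₂ = g∉ (x∈p∩q⁺ (g∈₁ , g∈₂))

  cover-cases : ∀ {X Z} → Cover X Z → ∀ a → (a ≢ fzero × Tight X Z a) ⊎ ∣ bundle X a ∩ ∁ Z ∣ ≡ 0
  cover-cases {X} {Z} cover a with nonempty? (bundle X a ∩ ∁ Z)
  ... | yes (g , g∈) = inj₁ (subst (λ b → b ≢ fzero × Tight X Z b) (∈-bundle⁻ X (p∩q⊆p _ _ g∈))
                               (cover g (x∈∁p⇒x∉p (p∩q⊆q _ _ g∈))))
  ... | no empty     = inj₂ (trans (cong ∣_∣ (Empty-unique empty)) (∣⊥∣≡0 m))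

  -- Only sizes are compared, since a transfer may replace goods in many bundles. A tight agent
  -- cannot hold more inside `Z` than before, so it must hold at least as much outside; the other
  -- agents held nothing outside.
  module Persistence {X X′ : Allocation n m} (nr′ : NonRedundant v X′)
    (grow : ∀ i → ∣ bundle X (fsuc i) ∣ ≤ ∣ bundle X′ (fsuc i) ∣) {Z} (cover : Cover X Z) where

    private
      grow′ : ∀ {a} → a ≢ fzero → ∣ bundle X a ∣ ≤ ∣ bundle X′ a ∣
      grow′ {fzero}  a≢0 = contradiction refl a≢0
      grow′ {fsuc i} _   = grow i

      split-grow : ∀ {a} → a ≢ fzero → ∣ bundle X a ∩ Z ∣ + ∣ bundle X a ∩ ∁ Z ∣
                                       ≤ ∣ bundle X′ a ∩ Z ∣ + ∣ bundle X′ a ∩ ∁ Z ∣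
      split-grow {a} a≢0 = begin
        ∣ bundle X a ∩ Z ∣ + ∣ bundle X a ∩ ∁ Z ∣   ≡⟨ ∣∣-split (bundle X a) Z ⟨
        ∣ bundle X a ∣                              ≤⟨ grow′ a≢0 ⟩
        ∣ bundle X′ a ∣                             ≡⟨ ∣∣-split (bundle X′ a) Z ⟩
        ∣ bundle X′ a ∩ Z ∣ + ∣ bundle X′ a ∩ ∁ Z ∣ ∎

      inside-≥ : ∀ {a} → Tight X Z a → ∣ bundle X′ a ∩ Z ∣ ≤ ∣ bundle X a ∩ Z ∣
      inside-≥ {a} tight = begin
        ∣ bundle X′ a ∩ Z ∣     ≡⟨ V.independent-⊆ a (nr′ a) (p∩q⊆p _ _) ⟨
        V a (bundle X′ a ∩ Z)   ≤⟨ V.mono a (p∩q⊆q _ _) ⟩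
        V a Z                   ≤⟨ tight ⟩
        ∣ bundle X a ∩ Z ∣      ∎

      outside-≤ : ∀ a → ∣ bundle X a ∩ ∁ Z ∣ ≤ ∣ bundle X′ a ∩ ∁ Z ∣
      outside-≤ a with cover-cases cover a
      ... | inj₂ empty rewrite empty = z≤n
      ... | inj₁ (a≢0 , tight) = +-cancelˡ-≤ ∣ bundle X a ∩ Z ∣ _ _
        (≤-trans (split-grow a≢0) (+-monoˡ-≤ _ (inside-≥ tight)))

      outside-≥ : ∀ a → ∣ bundle X′ a ∩ ∁ Z ∣ ≤ ∣ bundle X a ∩ ∁ Z ∣
      -- Both allocations distribute the same goods outside `Z`, so no inequality in `outside-≤` can
      -- be strict.
      outside-≥ = sum-≤-tight outside-≤
        (≤-reflexive (trans (∣bundle∩∣-total X′ (∁ Z)) (sym (∣bundle∩∣-total X (∁ Z)))))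

    tight-persists : ∀ {a} → a ≢ fzero → Tight X Z a → Tight X′ Z a
    tight-persists {a} a≢0 tight = ≤-trans tight (+-cancelʳ-≤ ∣ bundle X a ∩ ∁ Z ∣ _ _
      (≤-trans (split-grow a≢0) (+-monoʳ-≤ _ (outside-≥ a))))

    tight-no-growth : ∀ {a} → Tight X Z a → ∣ bundle X′ a ∣ ≤ ∣ bundle X a ∣
    tight-no-growth {a} tight = begin
      ∣ bundle X′ a ∣                             ≡⟨ ∣∣-split (bundle X′ a) Z ⟩
      ∣ bundle X′ a ∩ Z ∣ + ∣ bundle X′ a ∩ ∁ Z ∣ ≤⟨ +-mono-≤ (inside-≥ tight) (outside-≥ a) ⟩
      ∣ bundle X a ∩ Z ∣ + ∣ bundle X a ∩ ∁ Z ∣   ≡⟨ ∣∣-split (bundle X a) Z ⟨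
      ∣ bundle X a ∣                              ∎

    cover-persists : Cover X′ Z
    cover-persists g g∉Z with cover-cases cover (X′ g)
    ... | inj₁ (a≢0 , tight) = a≢0 , tight-persists a≢0 tight
    ... | inj₂ empty = contradiction (begin-strict
        0                                <⟨ ≤-reflexive (sym (∣⁅x⁆∣≡1 g)) ⟩
        ∣ ⁅ g ⁆ ∣                        ≤⟨ p⊆q⇒∣p∣≤∣q∣ (⁅⁆⊆ (x∈p∩q⁺ (∈-bundle⁺ X′ refl , x∉p⇒x∈∁p g∉Z))) ⟩
        ∣ bundle X′ (X′ g) ∩ ∁ Z ∣       ≤⟨ outside-≥ (X′ g) ⟩
        ∣ bundle X (X′ g) ∩ ∁ Z ∣        ≡⟨ empty ⟩
        0                                ∎) (<-irrefl refl)

  module _ {X : Allocation n m} {Z} (cover : Cover X Z) {c : Fin n → ℕ}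
    (below : ∀ i → ∣ bundle X (fsuc i) ∣ ≤ c i)
    (reached : ∀ i → Tight X Z (fsuc i) ⊎ c i ≤ ∣ bundle X (fsuc i) ∣) where

    private
      leftover : Allocation n m → Fin (suc n) → ℕ
      leftover Y a = ∣ bundle Y a ∩ ∁ Z ∣

      unallocated : leftover X fzero ≡ 0
      unallocated with cover-cases cover fzero
      ... | inj₁ (0≢0 , _) = contradiction refl 0≢0
      ... | inj₂ empty     = empty

      -- An agent may do better in `Y` by taking goods outside `Z`; the leftover terms charge it for
      -- them. A tight agent gets at most `p` from `Z` in any allocation. An agent not known to be
      -- tight has no leftover in `X` and has reached its cap, so the left side is zero.
      deficit-≤ : ∀ Y i → (c i ∸ ∣ bundle X (fsuc i) ∣) + leftover X (fsuc i)
                        ≤ (c i ∸ v i (bundle Y (fsuc i))) + leftover Y (fsuc i)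
      deficit-≤ Y i = [ tight-case ∘ proj₂ , (λ empty → [ tight-case , full-case empty ]′ (reached i)) ]′
                        (cover-cases cover (fsuc i))
        where
        x = ∣ bundle X (fsuc i) ∣
        y = v i (bundle Y (fsuc i))
        p = ∣ bundle X (fsuc i) ∩ Z ∣
        q = leftover X (fsuc i)
        r = leftover Y (fsuc i)
        full-case : q ≡ 0 → c i ≤ x → c i ∸ x + q ≤ c i ∸ y + r
        full-case q≡0 c≤x rewrite q≡0 | m≤n⇒m∸n≡0 c≤x = z≤n
        y≤ : Tight X Z (fsuc i) → y ≤ p + r
        y≤ tight = begin
          y                                        ≤⟨ V.subadditive (fsuc i) split ⟩
          v i Z + v i (bundle Y (fsuc i) ∩ ∁ Z)    ≤⟨ +-mono-≤ tight (V.v≤∣∣ (fsuc i) _) ⟩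
          p + r                                    ∎
          where
          split : bundle Y (fsuc i) ⊆ₛ Z ∪ (bundle Y (fsuc i) ∩ ∁ Z)
          split {g} g∈ with g ∈? Z
          ... | yes g∈Z = x∈p∪q⁺ (inj₁ g∈Z)
          ... | no  g∉Z = x∈p∪q⁺ (inj₂ (x∈p∩q⁺ (g∈ , x∉p⇒x∈∁p g∉Z)))
        tight-case : Tight X Z (fsuc i) → c i ∸ x + q ≤ c i ∸ y + r
        tight-case tight = +-cancelˡ-≤ p _ _ (begin
          p + (c i ∸ x + q)   ≡⟨ swap p (c i ∸ x) q ⟩
          c i ∸ x + (p + q)   ≡⟨ cong (c i ∸ x +_) (∣∣-split (bundle X (fsuc i)) Z) ⟨
          c i ∸ x + x         ≡⟨ m∸n+n≡m (below i) ⟩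
          c i                 ≤⟨ m≤n+m∸n (c i) y ⟩
          y + (c i ∸ y)       ≤⟨ +-monoˡ-≤ _ (y≤ tight) ⟩
          p + r + (c i ∸ y)   ≡⟨ swap′ p r (c i ∸ y) ⟩
          p + (c i ∸ y + r)   ∎)
          where
          swap : ∀ a b d → a + (b + d) ≡ b + (a + d)
          swap = solve-∀
          swap′ : ∀ a b d → a + b + d ≡ a + (d + b)
          swap′ = solve-∀

    -- On summation the charges cancel: in `X` the agents of N own all goods outside `Z`, and in `Y`
    -- they cannot own more.
    deficit-minimal : ∀ Y → sum (λ i → c i ∸ ∣ bundle X (fsuc i) ∣) ≤ sum (λ i → c i ∸ v i (bundle Y (fsuc i)))
    deficit-minimal Y = +-cancelʳ-≤ (sum (leftover X ∘ fsuc)) _ _ (begin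
      sum dX + sum (leftover X ∘ fsuc)                   ≡⟨ ∑-distrib-+ dX (leftover X ∘ fsuc) ⟨
      sum (λ i → dX i + leftover X (fsuc i))             ≤⟨ sum-mono (deficit-≤ Y) ⟩
      sum (λ i → dY i + leftover Y (fsuc i))             ≡⟨ ∑-distrib-+ dY (leftover Y ∘ fsuc) ⟩
      sum dY + sum (leftover Y ∘ fsuc)                   ≤⟨ +-monoʳ-≤ (sum dY) total ⟩
      sum dY + sum (leftover X ∘ fsuc)                   ∎)
      where
      dX dY : Fin n → ℕ
      dX i = c i ∸ ∣ bundle X (fsuc i) ∣
      dY i = c i ∸ v i (bundle Y (fsuc i))
      total : sum (leftover Y ∘ fsuc) ≤ sum (leftover X ∘ fsuc)
      total = begin
        sum (leftover Y ∘ fsuc)         ≤⟨ m≤n+m _ (leftover Y fzero) ⟩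
        sum (leftover Y)                ≡⟨ ∣bundle∩∣-total Y (∁ Z) ⟩
        ∣ ∁ Z ∣                        ≡⟨ ∣bundle∩∣-total X (∁ Z) ⟨
        sum (leftover X)                ≡⟨ cong (_+ sum (leftover X ∘ fsuc)) unallocated ⟩
        sum (leftover X ∘ fsuc)         ∎

-- Runs of Yankee Swap

argmin : ∀ {n} {_≲_ : Fin n → Fin n → Set} →
         (∀ {i j k} → i ≲ j → j ≲ k → i ≲ k) → (∀ i j → i ≲ j ⊎ j ≲ i) →
         ∀ P → Nonempty P → ∃ λ i → i ∈ₛ P × (∀ k → k ∈ₛ P → i ≲ k)
argmin {n} {_≲_} ≲-trans ≲-total = subset-ind _ (λ { (_ , i∈⊥) → contradiction i∈⊥ ∉⊥ }) step
  where
  Min : Subset n → Set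
  Min P = ∃ λ i → i ∈ₛ P × (∀ k → k ∈ₛ P → i ≲ k)
  ≲-refl : ∀ i → i ≲ i
  ≲-refl i = [ id , id ]′ (≲-total i i)
  step : ∀ S g → g ∉ₛ S → (Nonempty S → Min S) → Nonempty (S ∪ ⁅ g ⁆) → Min (S ∪ ⁅ g ⁆)
  step S g _ ih _ with nonempty? S
  ... | no empty = g , x∈p∪q⁺ (inj₂ (x∈⁅x⁆ g)) , λ k k∈ →
    [ (λ k∈S → contradiction (k , k∈S) empty) , (λ k∈g → subst (g ≲_) (sym (x∈⁅y⁆⇒x≡y g k∈g)) (≲-refl g)) ]′
      (x∈p∪q⁻ S ⁅ g ⁆ k∈)
  ... | yes ne with ih ne
  ...   | i , i∈S , i≲ with ≲-total i g
  ...     | inj₁ i≲g = i , x∈p∪q⁺ (inj₁ i∈S) , λ k k∈ →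
    [ i≲ k , (λ k∈g → subst (i ≲_) (sym (x∈⁅y⁆⇒x≡y g k∈g)) i≲g) ]′ (x∈p∪q⁻ S ⁅ g ⁆ k∈)
  ...     | inj₂ g≲i = g , x∈p∪q⁺ (inj₂ (x∈⁅x⁆ g)) , λ k k∈ →
    [ (λ k∈S → ≲-trans g≲i (i≲ k k∈S)) , (λ k∈g → subst (g ≲_) (sym (x∈⁅y⁆⇒x≡y g k∈g)) (≲-refl g)) ]′
      (x∈p∪q⁻ S ⁅ g ⁆ k∈)

module YankeeSwap {n m : ℕ} (v : Fin n → Valuation m) (π : Fin n → Fin n) (mrf : ∀ i → IsMRF (v i)) where
  open Certificates v mrf
  open ≤-Reasoning

  size : Allocation n m → Fin n → ℕ
  size X i = ∣ bundle X (fsuc i) ∣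

  -- The path is arbitrary, not only one found by the search. `TransferPath` prescribes how each
  -- utility changes, and counting goods shows that the sizes change in the same way.
  transfer-nonRedundant : ∀ {X i gs} → NonRedundant v X → TransferPath v X (fsuc i) fzero gs →
                          NonRedundant v (applyPath X (fsuc i) gs)
  transfer-size : ∀ {X i gs} → TransferPath v X (fsuc i) fzero gs →
                  ∀ k → size (applyPath X (fsuc i) gs) k ≡ size X k + δ i k
  transfer-size {X} {i} tp k with TransferPath.ends-in-j tp
  ... | init , gk , refl , owner = trans (sym (+-identityʳ _))
    (subst (λ a → size (applyPath X (fsuc i) (init ∷ʳ gk)) k + δ a (fsuc k) ≡ size X k + δ i k)
      owner (∣bundle-applyPath∣ X (fsuc i) init gk (TransferPath.distinct tp) (fsuc k)))

  transfer-size-self : ∀ {X i gs} → TransferPath v X (fsuc i) fzero gs →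
                       size (applyPath X (fsuc i) gs) i ≡ suc (size X i)
  transfer-size-self {X} {i} tp = trans (transfer-size tp i) (trans (cong (size X i +_) (δ-refl i)) (+-comm _ 1))

  transfer-size-other : ∀ {X i gs} → TransferPath v X (fsuc i) fzero gs →
                        ∀ {k} → i ≢ k → size (applyPath X (fsuc i) gs) k ≡ size X k
  transfer-size-other {X} {i} tp {k} i≢k =
    trans (transfer-size tp k) (trans (cong (size X k +_) (δ-≢ i≢k)) (+-identityʳ _))

  transfer-grow : ∀ {X i gs} → TransferPath v X (fsuc i) fzero gs →
                  ∀ k → size X k ≤ size (applyPath X (fsuc i) gs) k
  transfer-grow tp k = ≤-trans (m≤m+n _ _) (≤-reflexive (sym (transfer-size tp k)))

  transfer-nonRedundant nr tp fzero = refl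
  transfer-nonRedundant {i = i} nr tp (fsuc k) with i F.≟ k
  ... | yes refl = trans (TransferPath.gain-i tp) (trans (cong suc (nr (fsuc i))) (sym (transfer-size-self tp)))
  ... | no i≢k   = trans (TransferPath.others tp (fsuc k) (i≢k ∘ sym ∘ F.suc-injective) λ ())
                     (trans (nr (fsuc k)) (sym (transfer-size-other tp i≢k)))

  tight⇒no-transfer : ∀ {X Z i} → NonRedundant v X → Cover X Z → Tight X Z (fsuc i) →
                      ¬ (∃ λ gs → TransferPath v X (fsuc i) fzero gs)
  tight⇒no-transfer nr cover tight (gs , tp) = <-irrefl refl
    (≤-trans (≤-reflexive (sym (transfer-size-self tp)))
      (Persistence.tight-no-growth {X′ = applyPath _ _ gs} (transfer-nonRedundant nr tp) (transfer-grow tp) cover tight))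

  step-wellFounded : WellFounded (λ s′ s → YSStep v π s s′)
  step-wellFounded = Subrelation.wellFounded decrease (On.wellFounded measure <-wellFounded)
    where
    measure : State n m → ℕ
    measure (X , P) = ∣ bundle X fzero ∣ + ∣ P ∣
    decrease : ∀ {s′ s} → YSStep v π s s′ → measure s′ < measure s
    decrease {s = X , P} (transfer gs _ tp)  = +-monoˡ-≤ ∣ P ∣ (≤-reflexive (TransferPath.lose-j tp))
    decrease {s = X , P} (remove (i∈P , _) _) = +-monoʳ-< ∣ bundle X fzero ∣ (x∈p⇒∣p-x∣<∣p∣ i∈P)

  module _ (X : Allocation n m) where

    Before : Fin n → Fin n → Set
    Before i k = (size X i < size X k) ⊎ ((size X i ≡ size X k) × (toℕ (π i) ≤ toℕ (π k)))

    before-trans : ∀ {i j k} → Before i j → Before j k → Before i k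
    before-trans (inj₁ p)       (inj₁ q)       = inj₁ (<-trans p q)
    before-trans (inj₁ p)       (inj₂ (q , _)) = inj₁ (≤-trans p (≤-reflexive q))
    before-trans (inj₂ (p , _)) (inj₁ q)       = inj₁ (≤-trans (≤-reflexive (cong suc p)) q)
    before-trans (inj₂ (p , r)) (inj₂ (q , s)) = inj₂ (trans p q , ≤-trans r s)

    before-total : ∀ i j → Before i j ⊎ Before j i
    before-total i j with <-cmp (size X i) (size X j)
    ... | tri< lt _ _ = inj₁ (inj₁ lt)
    ... | tri> _ _ gt = inj₂ (inj₁ gt)
    ... | tri≈ _ eq _ = Sum.map (λ le → inj₂ (eq , le)) (λ le → inj₂ (sym eq , le))
                          (≤-total (toℕ (π i)) (toℕ (π j)))

  run : ∀ {X P} → Acc (λ s′ s → YSStep v π s s′) (X , P) → NonRedundant v X →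
        ∃ λ Y → Star (YSStep v π) (X , P) (Y , ⊥)
  run {X} {P} (acc rs) nr with nonempty? P
  ... | no empty rewrite Empty-unique empty = X , ε
  ... | yes ne with argmin {_≲_ = Before X} (before-trans X) (before-total X) P ne
  ...   | i , selected with transfer-or-cover nr i
  ...     | inj₁ (gs , tp) = let step = transfer gs selected tp
                                 Y , steps = run (rs step) (transfer-nonRedundant nr tp)
                             in Y , step ◅ steps
  ...     | inj₂ (Z , cover , tight) = let step = remove selected (tight⇒no-transfer nr cover tight)
                                           Y , steps = run (rs step) nr
                                       in Y , step ◅ steps

  -- The key of the next unit that agent `i` would receive. For non-redundant `X` it equals
  -- `augUtil v π X i`.
  key : Allocation n m → Fin n → ℕ
  key X i = n * n * size X i + suc (toℕ (π i))

  rank≤n*n : ∀ i → suc (toℕ (π i)) ≤ n * n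
  rank≤n*n i = ≤-trans (F.toℕ<n (π i)) (m≤m*n n n {{F.nonZeroIndex i}})

  -- One more good adds `n * n`, which no rank exceeds, so the order of keys respects size first and
  -- priority second.
  before⇒key≤ : ∀ X {i k} → Before X i k → key X i ≤ key X k
  before⇒key≤ X (inj₂ (eq , le)) = +-mono-≤ (≤-reflexive (cong (n * n *_) eq)) (s≤s le)
  before⇒key≤ X {i} {k} (inj₁ lt) = begin
    n * n * size X i + suc (toℕ (π i)) ≤⟨ +-monoʳ-≤ _ (rank≤n*n i) ⟩
    n * n * size X i + n * n           ≡⟨ +-comm _ (n * n) ⟩
    n * n + n * n * size X i           ≡⟨ *-suc (n * n) (size X i) ⟨
    n * n * suc (size X i)             ≤⟨ *-monoʳ-≤ (n * n) lt ⟩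
    n * n * size X k                   ≤⟨ m≤m+n _ _ ⟩
    key X k                            ∎

  -- c i is the number of units of agent i whose key lies below θ.
  CapsAt : ℕ → (Fin n → ℕ) → Set
  CapsAt θ c = ∀ i a → c i ≤ a ⇔ θ ≤ n * n * a + suc (toℕ (π i))

  -- The left sum counts the units with key below `θ` that have not been granted. `CapsAt θ`
  -- determines `c`; quantifying over it postpones its formula, a rounded-up quotient.
  Optimal : ℕ → Allocation n m → Set
  Optimal θ X = ∀ c → CapsAt θ c → ∀ Y →
    sum (λ i → c i ∸ size X i) ≤ sum (λ i → c i ∸ v i (bundle Y (fsuc i)))

  -- `level` is the key of the latest granted unit, or 0 at the start. Granted keys never exceed it,
  -- and the next key of an agent is `n * n` above its last one; this gives `key≤level`. The one set
  -- `Z` serves all removed agents.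
  record Invariant (X : Allocation n m) (P : Subset n) : Set where
    field
      nonRedundant : NonRedundant v X
      level        : ℕ
      level≤key    : ∀ {i} → i ∈ₛ P → level ≤ key X i
      key≤level    : ∀ i → key X i ≤ level + n * n
      {Z}          : Subset m
      cover        : Cover X Z
      tight        : ∀ {i} → i ∉ₛ P → Tight X Z (fsuc i)
      optimal      : ∀ {θ} → θ ≤ level → Optimal θ X

  -- For `θ` above `level`, every granted unit has key below `θ`, so no agent exceeds its cap.
  -- Agents still in `P` have reached their caps because their next keys are at least `κ`, and
  -- removed agents are tight. Hence `deficit-minimal` applies.
  optimal-up-to : ∀ {X P} → Invariant X P → ∀ {κ} → (∀ {i} → i ∈ₛ P → κ ≤ key X i) →
                  ∀ {θ} → θ ≤ κ → Optimal θ X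
  optimal-up-to {X} {P} inv {κ} κ≤key {θ} θ≤κ c caps Y with θ ≤? Invariant.level inv
  ... | yes θ≤level = Invariant.optimal inv θ≤level c caps Y
  ... | no  θ≰level = deficit-minimal cover below reached Y
    where
    open Invariant inv
    below : ∀ i → size X i ≤ c i
    below i with size X i | key≤level i
    ... | zero  | _ = z≤n
    -- The last unit granted to `i` took it from `b` to `suc b` goods; its key is `n * n` less than
    -- `key X i`, hence at most `level`.
    ... | suc b | le = ≰⇒> λ c≤b → θ≰level (≤-trans (Equivalence.to (caps i b) c≤b)
      (+-cancelʳ-≤ (n * n) _ _ (≤-trans (≤-reflexive (shift (n * n) b (suc (toℕ (π i))))) le)))
      where
      shift : ∀ N b p → N * b + p + N ≡ N * suc b + p
      shift = solve-∀
    reached : ∀ i → Tight X Z (fsuc i) ⊎ c i ≤ size X i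
    reached i with i ∈? P
    ... | yes i∈P = inj₂ (Equivalence.from (caps i (size X i)) (≤-trans θ≤κ (κ≤key i∈P)))
    ... | no  i∉P = inj₁ (tight i∉P)

  invariant-step : ∀ {X P X′ P′} → YSStep v π (X , P) (X′ , P′) → Invariant X P → Invariant X′ P′
  invariant-step {X} {P} (transfer {i = i} gs (i∈P , first) tp) inv = record
    { nonRedundant = transfer-nonRedundant nonRedundant tp
    ; level        = key X i
    ; level≤key    = λ {k} k∈P → ≤-trans (key-min k∈P) (+-monoˡ-≤ _ (*-monoʳ-≤ (n * n) (transfer-grow tp k)))
    ; key≤level    = key≤
    ; cover        = cover-persists
    ; tight        = tight-persists (λ ()) ∘ tight
    -- The deficit was already minimal before the transfer for every `θ` up to the new level, and
    -- larger bundles can only lower it.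
    ; optimal      = λ θ≤ c caps Y → ≤-trans
        (sum-mono λ k → ∸-monoʳ-≤ (c k) (transfer-grow tp k))
        (optimal-up-to inv key-min θ≤ c caps Y)
    }
    where
    open Invariant inv
    open Persistence {X} {applyPath X (fsuc i) gs} (transfer-nonRedundant nonRedundant tp) (transfer-grow tp) cover
    X′ = applyPath X (fsuc i) gs
    key-min : ∀ {k} → k ∈ₛ P → key X i ≤ key X k
    key-min {k} k∈P = before⇒key≤ X (first k k∈P)
    key≤ : ∀ k → key X′ k ≤ key X i + n * n
    key≤ k with i F.≟ k
    ... | yes refl rewrite transfer-size-self tp = ≤-reflexive (shift (n * n) (size X i) _)
      where
      shift : ∀ N b p → N * suc b + p ≡ N * b + p + N
      shift = solve-∀
    ... | no i≢k rewrite transfer-size-other tp i≢k =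
      ≤-trans (key≤level k) (+-monoˡ-≤ (n * n) (level≤key i∈P))
  invariant-step {X} {P} (remove {i = i} selected ¬path) inv with transfer-or-cover (Invariant.nonRedundant inv) i
  ... | inj₁ path = contradiction path ¬path
  ... | inj₂ (Z₂ , cover₂ , tight₂) = record
    { nonRedundant = nonRedundant
    ; level        = level
    ; level≤key    = level≤key ∘ p─q⊆p _ _
    ; key≤level    = key≤level
    -- The set for the agents removed earlier is intersected with the one found for `i`.
    ; cover        = cover-∩ nonRedundant cover cover₂
    ; tight        = tight′
    ; optimal      = optimal
    }
    where
    open Invariant inv
    tight′ : ∀ {k} → k ∉ₛ P - i → Tight X (Z ∩ Z₂) (fsuc k)
    tight′ {k} k∉ with k F.≟ i
    ... | yes refl = tight-∩ʳ nonRedundant cover tight₂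
    ... | no  k≢i  = tight-∩ nonRedundant (tight λ k∈P → k∉ (x∈p∧x≢y⇒x∈p-y k∈P k≢i)) cover₂

  initial-bundle : ∀ i → bundle {n} {m} (λ _ → fzero) (fsuc i) ≡ ⊥
  initial-bundle i = Empty-unique λ { (g , g∈) → contradiction (∈-bundle⁻ {n} {m} (λ _ → fzero) {fsuc i} g∈) λ () }

  initial-nonRedundant : NonRedundant v (λ _ → fzero)
  initial-nonRedundant fzero    = refl
  initial-nonRedundant (fsuc i) = trans (cong (v i) (initial-bundle i))
    (trans (IsMRF.empty-zero (mrf i)) (trans (sym (∣⊥∣≡0 m)) (cong ∣_∣ (sym (initial-bundle i)))))

  initial-invariant : Invariant (λ _ → fzero) ⊤
  initial-invariant = record
    { nonRedundant = initial-nonRedundant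
    ; level        = 0
    ; level≤key    = λ _ → z≤n
    ; key≤level    = key≤
    ; Z            = ⊤
    ; cover        = λ g g∉⊤ → contradiction ∈⊤ g∉⊤
    ; tight        = λ i∉⊤ → contradiction ∈⊤ i∉⊤
    ; optimal      = λ θ≤0 c caps Y → sum-mono λ i →
        ≤-trans (m∸n≤m (c i) (size (λ _ → fzero) i)) (≤-trans (Equivalence.from (caps i 0) (≤-trans θ≤0 z≤n)) z≤n)
    }
    where
    key≤ : ∀ i → key (λ _ → fzero) i ≤ n * n
    key≤ i rewrite initial-bundle i | ∣⊥∣≡0 m | *-zeroʳ (n * n) = rank≤n*n i

  invariant-star : ∀ {X P X′ P′} → Star (YSStep v π) (X , P) (X′ , P′) → Invariant X P → Invariant X′ P′
  invariant-star ε              inv = inv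
  invariant-star (step ◅ steps) inv = invariant-star steps (invariant-step step inv)

  output-nonRedundant : ∀ {X} → Output v π X → NonRedundant v X
  output-nonRedundant out = Invariant.nonRedundant (invariant-star out initial-invariant)

  -- With no agents left in `P` the bound on `κ` is vacuous, so `κ` can be `θ` itself.
  output-optimal : ∀ {X} → Output v π X → ∀ θ → Optimal θ X
  output-optimal out θ = optimal-up-to (invariant-star out initial-invariant) (λ i∈⊥ → contradiction i∈⊥ ∉⊥) ≤-refl

-- Lorenz domination

module _ where
  open ≤-Reasoning

  private
    interchange : ∀ a b c d → a + b + (c + d) ≡ a + c + (b + d)
    interchange = solve-∀

  -- Weak duality: each of the first `k` entries satisfies `t ≤ x + (t ∸ x)`, and the remaining
  -- deficits are nonnegative. No sorting is involved.
  smallest-≤-truncated : ∀ k t xs → k ≤ length xs →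
    k * t ≤ ListAction.sum (take k xs) + ListAction.sum (map (t ∸_) xs)
  smallest-≤-truncated zero    t xs       _        = z≤n
  smallest-≤-truncated (suc k) t (x ∷ xs) (s≤s k≤) = begin
    t + k * t             ≤⟨ +-mono-≤ (m≤n+m∸n t x) (smallest-≤-truncated k t xs k≤) ⟩
    x + (t ∸ x) + (S + D) ≡⟨ interchange x (t ∸ x) S D ⟩
    x + S + ((t ∸ x) + D) ∎
    where
    S = ListAction.sum (take k xs)
    D = ListAction.sum (map (t ∸_) xs)

  truncated-at-head : ∀ {x xs} t → t ≤ x → Linked _≤_ (x ∷ xs) → ListAction.sum (map (t ∸_) (x ∷ xs)) ≡ 0
  truncated-at-head {x}              t t≤x [-]          rewrite m≤n⇒m∸n≡0 t≤x = refl
  truncated-at-head {x} {xs = _ ∷ _} t t≤x (x≤y ∷ link) rewrite m≤n⇒m∸n≡0 t≤x =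
    truncated-at-head t (≤-trans t≤x x≤y) link

  -- Equality holds in the duality when `t` is the last entry taken: earlier entries are at most
  -- `t`, and later ones have deficit zero. The bound `x ≤ t` is carried along for the induction.
  smallest-≡-truncated : ∀ k x xs → k ≤ length xs → Linked _≤_ (x ∷ xs) → ∃ λ t → x ≤ t ×
    ListAction.sum (take (suc k) (x ∷ xs)) + ListAction.sum (map (t ∸_) (x ∷ xs)) ≡ suc k * t
  smallest-≡-truncated zero x xs _ link = x , ≤-refl ,
    trans (cong (x + 0 +_) (truncated-at-head x ≤-refl link)) (+-identityʳ _)
  smallest-≡-truncated (suc k) x (y ∷ ys) (s≤s k≤) (x≤y ∷ link) with smallest-≡-truncated k y ys k≤ link
  ... | t , y≤t , eq = t , x≤t , trans (interchange x _ (t ∸ x) _) (cong₂ _+_ (m+[n∸m]≡n x≤t) eq)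
    where
    x≤t = ≤-trans x≤y y≤t

  -- The threshold `t` is chosen to give equality for `ys`; for `xs` the same `t` still gives an
  -- inequality in the needed direction. Deficit sums do not depend on the order.
  truncated⇒smallest : ∀ xs ys → (∀ t → ListAction.sum (map (t ∸_) xs) ≤ ListAction.sum (map (t ∸_) ys)) →
    ∀ k → k ≤ length xs → k ≤ length ys → ListAction.sum (take k (sort ys)) ≤ ListAction.sum (take k (sort xs))
  truncated⇒smallest xs ys trunc≤ zero    _   _   = z≤n
  truncated⇒smallest xs ys trunc≤ (suc k) k≤x k≤y
    with sort ys | sort-↭ ys | sort-↗ ys | subst (suc k ≤_) (sym (↭-length (sort-↭ ys))) k≤y
  ... | z ∷ zs | perm | sorted | s≤s k≤ with smallest-≡-truncated k z zs k≤ sorted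
  ...   | t , _ , eq = +-cancelʳ-≤ (ListAction.sum (map (t ∸_) (z ∷ zs))) _ _ (begin
    ListAction.sum (take (suc k) (z ∷ zs)) + ListAction.sum (map (t ∸_) (z ∷ zs))
      ≡⟨ eq ⟩
    suc k * t
      ≤⟨ smallest-≤-truncated (suc k) t (sort xs) (subst (suc k ≤_) (sym (↭-length (sort-↭ xs))) k≤x) ⟩
    ListAction.sum (take (suc k) (sort xs)) + ListAction.sum (map (t ∸_) (sort xs))
      ≡⟨ cong (ListAction.sum (take (suc k) (sort xs)) +_) (sum-↭ (map⁺ (t ∸_) (sort-↭ xs))) ⟩
    ListAction.sum (take (suc k) (sort xs)) + ListAction.sum (map (t ∸_) xs)
      ≤⟨ +-monoʳ-≤ (ListAction.sum (take (suc k) (sort xs))) (trunc≤ t) ⟩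
    ListAction.sum (take (suc k) (sort xs)) + ListAction.sum (map (t ∸_) ys)
      ≡⟨ cong (ListAction.sum (take (suc k) (sort xs)) +_) (sum-↭ (map⁺ (t ∸_) perm)) ⟨
    ListAction.sum (take (suc k) (sort xs)) + ListAction.sum (map (t ∸_) (z ∷ zs)) ∎)

  sum-allFin : ∀ {n} (f : Fin n → ℕ) → ListAction.sum (map f (allFin n)) ≡ sum f
  sum-allFin {n} f = trans (cong ListAction.sum (map-tabulate id f)) (sum-tabulate f)
    where
    sum-tabulate : ∀ {n} (f : Fin n → ℕ) → ListAction.sum (tabulate f) ≡ sum f
    sum-tabulate {zero}  f = refl
    sum-tabulate {suc n} f = cong (f fzero +_) (sum-tabulate (f ∘ fsuc))

-- Division rounded up.

module Ceiling (M : ℕ) where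
  N = suc M

  ⌈_/N⌉ : ℕ → ℕ
  ⌈ zero  /N⌉ = 0
  ⌈ suc e /N⌉ = suc (e / N)

  -- The Galois connection characterising the ceiling; `CapsAt` asks for this property.
  ⌈/⌉-≤ : ∀ e a → ⌈ e /N⌉ ≤ a ⇔ e ≤ N * a
  ⌈/⌉-≤ zero    a = mk⇔ (λ _ → z≤n) (λ _ → z≤n)
  ⌈/⌉-≤ (suc e) a = mk⇔ to (λ e< → m<n*o⇒m/o<n (subst (e <_) (*-comm N a) e<))
    where
    open ≤-Reasoning
    to : suc (e / N) ≤ a → suc e ≤ N * a
    to q<a = begin-strict
      e                     ≡⟨ m≡m%n+[m/n]*n e N ⟩
      e % N + (e / N) * N   <⟨ +-monoˡ-< _ (m%n<n e N) ⟩
      suc (e / N) * N       ≤⟨ *-monoˡ-≤ N q<a ⟩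
      a * N                 ≡⟨ *-comm a N ⟩
      N * a                 ∎

  -- Rounding up after subtracting `N ∸ 1` is rounding down. When `e ≤ M` the truncated subtraction
  -- makes both sides zero.
  ⌈∸/⌉ : ∀ e → ⌈ e ∸ M /N⌉ ≡ e / N
  ⌈∸/⌉ e with e <? N
  ... | yes (s≤s e≤M) rewrite m≤n⇒m∸n≡0 e≤M = sym (m<n⇒m/n≡0 (s≤s e≤M))
  ... | no e≮N with m≤n⇒∃[o]m+o≡n (≮⇒≥ e≮N)
  ...   | r , refl rewrite sym (+-suc M r) | m+n∸m≡n M (suc r) | +-suc M r =
    sym (trans (m/n≡1+[m∸n]/n {suc M + r} {N} (m≤m+n N r)) (cong (λ z → suc (z / N)) (m+n∸m≡n M r)))

  open ≡-Reasoning

  -- Hermite's identity.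
  ∑⌈/⌉ : ∀ a e → sum {N} (λ j → ⌈ e ∸ toℕ j /N⌉ ∸ a) ≡ e ∸ N * a
  ∑⌈/⌉ a zero = begin
    sum {N} (λ j → ⌈ 0 ∸ toℕ j /N⌉ ∸ a) ≡⟨ sum-cong-≗ {N} (λ j → trans (cong (λ z → ⌈ z /N⌉ ∸ a) (0∸n≡0 (toℕ j))) (0∸n≡0 a)) ⟩
    sum {N} (λ _ → 0)                   ≡⟨ sum-replicate-zero N ⟩
    0                                   ≡⟨ 0∸n≡0 (N * a) ⟨
    0 ∸ N * a                           ∎
  -- Passing from `e` to `suc e` shifts the summands by one place: `f (suc e)` enters and
  -- `f (e ∸ M)` leaves. They differ by one exactly when `a ≤ e / N`, that is, when `N * a ≤ e`, and
  -- agree otherwise.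
  ∑⌈/⌉ a (suc e) = +-cancelʳ-≡ (⌈ e ∸ M /N⌉ ∸ a) _ _ (begin
    f (suc e) + S + f (e ∸ M)      ≡⟨ +-assoc (f (suc e)) S _ ⟩
    f (suc e) + (S + f (e ∸ M))    ≡⟨ cong (f (suc e) +_) last ⟨
    f (suc e) + sum {N} (λ j → f (e ∸ toℕ j)) ≡⟨ cong (f (suc e) +_) (∑⌈/⌉ a e) ⟩
    f (suc e) + (e ∸ N * a)        ≡⟨ increment ⟩
    (suc e ∸ N * a) + f (e ∸ M)    ∎)
    where
    f : ℕ → ℕ
    f z = ⌈ z /N⌉ ∸ a
    S = sum {M} (λ j → f (e ∸ toℕ j))
    last : sum {N} (λ j → f (e ∸ toℕ j)) ≡ S + f (e ∸ M)
    last = trans (sum-init-last {M} (λ j → f (e ∸ toℕ j)))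
      (cong₂ _+_ (sum-cong-≗ {M} (λ j → cong (λ z → f (e ∸ z)) (F.toℕ-inject₁ j)))
                 (cong (λ z → f (e ∸ z)) (F.toℕ-fromℕ M)))
    Na≤e : a ≤ e / N → N * a ≤ e
    Na≤e a≤q = ≤-trans (≤-reflexive (*-comm N a)) (≤-trans (*-monoˡ-≤ N a≤q) (m/n*n≤m e N))
    e<Na : ¬ a ≤ e / N → e < N * a
    e<Na a≰q = Equivalence.to (⌈/⌉-≤ (suc e) a) (≰⇒> a≰q)
    increment : f (suc e) + (e ∸ N * a) ≡ (suc e ∸ N * a) + f (e ∸ M)
    increment rewrite ⌈∸/⌉ e with a ≤? e / N
    ... | yes a≤q rewrite +-∸-assoc 1 a≤q | +-∸-assoc 1 (Na≤e a≤q) = cong suc (+-comm (e / N ∸ a) _)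
    ... | no a≰q rewrite m≤n⇒m∸n≡0 (≰⇒> a≰q) | m≤n⇒m∸n≡0 (<⇒≤ (≰⇒> a≰q))
                       | m≤n⇒m∸n≡0 (e<Na a≰q) | m≤n⇒m∸n≡0 (<⇒≤ (e<Na a≰q)) = refl

output-lorenz : ∀ {n m} (v : Fin n → Valuation m) (π : Fin n → Fin n) (mrf : ∀ i → IsMRF (v i)) →
                ∀ {X} → Output v π X → LorenzDominatingWrt v π X
output-lorenz {zero}  v π mrf out Y (suc k) _ ()
output-lorenz {suc n} v π mrf {X} out Y k _ k≤ =
  truncated⇒smallest (map (augUtil v π X) agents) (map (augUtil v π Y) agents) truncated k
    (≤-trans k≤ (≤-reflexive (sym (length-agents X)))) (≤-trans k≤ (≤-reflexive (sym (length-agents Y))))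
  where
  open YankeeSwap v π mrf
  -- With this argument `N` is definitionally `suc n * suc n`, the square of the number of agents.
  open Ceiling (n + n * suc n)
  open ≤-Reasoning
  agents = allFin (suc n)
  length-agents : ∀ Y → length (map (augUtil v π Y) agents) ≡ suc n
  length-agents Y = trans (length-map (augUtil v π Y) agents) (length-tabulate id)

  p : Fin (suc n) → ℕ
  p i = suc (toℕ (π i))

  c : ℕ → Fin (suc n) → ℕ
  c θ i = ⌈ θ ∸ p i /N⌉

  caps : ∀ θ → CapsAt θ (c θ)
  caps θ i a = mk⇔
    (λ c≤a → ≤-trans (m≤n+m∸n θ (p i)) (≤-trans
      (+-monoʳ-≤ (p i) (Equivalence.to (⌈/⌉-≤ (θ ∸ p i) a) c≤a)) (≤-reflexive (+-comm (p i) _))))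
    (λ θ≤ → Equivalence.from (⌈/⌉-≤ (θ ∸ p i) a) (m≤n+o⇒m∸n≤o θ (p i) (subst (θ ≤_) (+-comm _ (p i)) θ≤)))

  -- Hermite's identity at `t ∸ p i`. Swapping the two subtractions moves the shift `j` into the
  -- threshold, so the thresholds `t ∸ toℕ j` are the same for all agents and the sums can be
  -- interchanged in `layered`.
  layers : ∀ t i a → t ∸ (N * a + p i) ≡ sum {N} (λ j → c (t ∸ toℕ j) i ∸ a)
  layers t i a = begin-equality
    t ∸ (N * a + p i)                          ≡⟨ cong (t ∸_) (+-comm (N * a) (p i)) ⟩
    t ∸ (p i + N * a)                          ≡⟨ ∸-+-assoc t (p i) (N * a) ⟨
    t ∸ p i ∸ N * a                            ≡⟨ ∑⌈/⌉ a (t ∸ p i) ⟨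
    sum {N} (λ j → ⌈ t ∸ p i ∸ toℕ j /N⌉ ∸ a)  ≡⟨ sum-cong-≗ {N} (λ j → cong (λ z → ⌈ z /N⌉ ∸ a) (∸-swap t (p i) (toℕ j))) ⟩
    sum {N} (λ j → c (t ∸ toℕ j) i ∸ a)        ∎
    where
    ∸-swap : ∀ a b c → a ∸ b ∸ c ≡ a ∸ c ∸ b
    ∸-swap a b c = trans (∸-+-assoc a b c) (trans (cong (a ∸_) (+-comm b c)) (sym (∸-+-assoc a c b)))

  u : Allocation (suc n) _ → Fin (suc n) → ℕ
  u W i = v i (bundle W (fsuc i))

  layered : ∀ t W → ListAction.sum (map (t ∸_) (map (augUtil v π W) agents))
                  ≡ sum {N} (λ j → sum (λ i → c (t ∸ toℕ j) i ∸ u W i))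
  layered t W = begin-equality
    ListAction.sum (map (t ∸_) (map (augUtil v π W) agents)) ≡⟨ cong ListAction.sum (map-∘ agents) ⟨
    ListAction.sum (map (λ i → t ∸ augUtil v π W i) agents)  ≡⟨ sum-allFin (λ i → t ∸ augUtil v π W i) ⟩
    sum (λ i → t ∸ augUtil v π W i)                          ≡⟨ sum-cong-≗ (λ i → layers t i (u W i)) ⟩
    sum (λ i → sum {N} (λ j → c (t ∸ toℕ j) i ∸ u W i))      ≡⟨ ∑-comm {suc n} {N} (λ i j → c (t ∸ toℕ j) i ∸ u W i) ⟩
    sum {N} (λ j → sum (λ i → c (t ∸ toℕ j) i ∸ u W i))      ∎

  truncated : ∀ t → ListAction.sum (map (t ∸_) (map (augUtil v π X) agents))
                  ≤ ListAction.sum (map (t ∸_) (map (augUtil v π Y) agents))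
  truncated t = begin
    ListAction.sum (map (t ∸_) (map (augUtil v π X) agents)) ≡⟨ layered t X ⟩
    sum {N} (λ j → sum (λ i → c (t ∸ toℕ j) i ∸ u X i))      ≤⟨ sum-mono {N} (λ j → layer (t ∸ toℕ j)) ⟩
    sum {N} (λ j → sum (λ i → c (t ∸ toℕ j) i ∸ u Y i))      ≡⟨ layered t Y ⟨
    ListAction.sum (map (t ∸_) (map (augUtil v π Y) agents)) ∎
    where
    layer : ∀ θ → sum (λ i → c θ i ∸ u X i) ≤ sum (λ i → c θ i ∸ u Y i)
    layer θ = begin
      sum (λ i → c θ i ∸ u X i)    ≡⟨ sum-cong-≗ (λ i → cong (c θ i ∸_) (output-nonRedundant out (fsuc i))) ⟩
      sum (λ i → c θ i ∸ size X i) ≤⟨ output-optimal out θ (c θ) (caps θ) Y ⟩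
      sum (λ i → c θ i ∸ u Y i)    ∎

theorem2 : ∀ {n m : ℕ} (v : Fin n → Valuation m) (π : Fin n → Fin n) →
    (∀ i → IsMRF (v i)) → Injective _≡_ _≡_ π →
    Terminates v π initState
    × (∃ λ X → Output v π X)
    × (∀ X → Output v π X → NonRedundant v X × LorenzDominatingWrt v π X)
theorem2 v π mrf _ =
    step-wellFounded initState
  , run (step-wellFounded initState) initial-nonRedundant
  , λ X out → output-nonRedundant out , output-lorenz v π mrf out
  where open YankeeSwap v π mrf
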